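{- Let $\Theta^{B}_{3,217}$ denote the $3$-uniform Berge theta hypergraph with $\ell=3$ and $t=217$. Then $\mathrm{ex}^{lin}_{3}(n,\Theta^{B}_{3,217})=\Theta(n^{4/3})$; that is, there are constants $c,C>0$ such that $c\,n^{4/3}\le \mathrm{ex}^{lin}_{3}(n,\Theta^{B}_{3,217})\le C\,n^{4/3}$ for all sufficiently large $n$.
   Context: A $3$-uniform hypergraph is linear if any two distinct hyperedges share at most one vertex. For a $3$-uniform hypergraph $F$, $\mathrm{ex}^{lin}_{3}(n,F)$ is the maximum number of hyperedges in a $3$-uniform linear hypergraph on $n$ vertices that contains no copy of $F$ (as a subhypergraph). The $3$-uniform Berge theta hypergraph $\Theta^{B}_{3,t}$ consists of distinct vertices $x,y,v^{i}_{1},v^{i}_{2}$ ($1\le i\le t$) and distinct hyperedges $e^{i}_{1},e^{i}_{2},e^{i}_{3}$ ($1\le i\le t$) such that $\{x,v^{i}_{1}\}\subseteq e^{i}_{1}$, $\{v^{i}_{1},v^{i}_{2}\}\subseteq e^{i}_{2}$ and $\{v^{i}_{2},y\}\subseteq e^{i}_{3}$ for every $1\le i\le t$. -}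

module Defs where

open import Data.Nat using (ℕ; _≤_; _*_; _^_)
open import Data.Fin using (Fin)
open import Data.Fin.Subset using (Subset; _∈_; _∩_; ∣_∣)
open import Data.List using (List; length; _∷_; _++_; tabulate)
open import Data.List.Membership.Propositional renaming (_∈_ to _∈ₗ_)
open import Data.List.Relation.Unary.All using (All)
open import Data.List.Relation.Unary.Unique.Propositional using (Unique)
open import Data.Product using (_×_; Σ; ∃; ∃-syntax)
open import Relation.Binary.PropositionalEquality using (_≡_; _≢_)

record Hypergraph3 (n : ℕ) : Set where
  constructor mkHG
  field
    edges    : List (Subset n)
    distinct : Unique edges
    uniform  : All (λ e → ∣ e ∣ ≡ 3) edges
open Hypergraph3 public

numEdges : {n : ℕ} → Hypergraph3 n → ℕ
numEdges H = length (edges H)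

Linear : {n : ℕ} → Hypergraph3 n → Set
Linear H = ∀ {e f} → e ∈ₗ edges H → f ∈ₗ edges H → e ≢ f → ∣ e ∩ f ∣ ≤ 1

record ThetaCopy {n : ℕ} (t : ℕ) (H : Hypergraph3 n) : Set where
  field
    x y         : Fin n
    v1 v2       : Fin t → Fin n
    e1 e2 e3    : Fin t → Subset n
    vertsDistinct : Unique (x ∷ y ∷ (tabulate v1 ++ tabulate v2))
    edgesDistinct : Unique (tabulate e1 ++ tabulate e2 ++ tabulate e3)
    e1∈H : ∀ i → e1 i ∈ₗ edges H
    e2∈H : ∀ i → e2 i ∈ₗ edges H
    e3∈H : ∀ i → e3 i ∈ₗ edges H
    x∈e1  : ∀ i → x ∈ e1 i
    v1∈e1 : ∀ i → v1 i ∈ e1 i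
    v1∈e2 : ∀ i → v1 i ∈ e2 i
    v2∈e2 : ∀ i → v2 i ∈ e2 i
    v2∈e3 : ∀ i → v2 i ∈ e3 i
    y∈e3  : ∀ i → y ∈ e3 i

ContainsTheta : {n : ℕ} → ℕ → Hypergraph3 n → Set
ContainsTheta t H = ThetaCopy t H

-- Lower bound  c·n^{4/3} ≤ ex^lin_3(n, Θ^B_{3,t})  for c = K^{-1/3}:
-- some linear Θ-free hypergraph on n vertices with m edges, n^4 ≤ K·m^3.
ExLinLower : ℕ → ℕ → ℕ → Set
ExLinLower t K n =
  Σ (Hypergraph3 n) λ H →
    Linear H × (ContainsTheta t H → Data.Empty.⊥) × (n ^ 4 ≤ K * numEdges H ^ 3)
  where import Data.Empty

-- Upper bound  ex^lin_3(n, Θ^B_{3,t}) ≤ C·n^{4/3}  for C = K^{1/3}: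
-- every linear Θ-free hypergraph on n vertices has m edges with m^3 ≤ K·n^4.
ExLinUpper : ℕ → ℕ → ℕ → Set
ExLinUpper t K n =
  (H : Hypergraph3 n) → Linear H → (ContainsTheta t H → Data.Empty.⊥) →
    numEdges H ^ 3 ≤ K * n ^ 4
  where import Data.Empty

{-# OPTIONS --safe #-}
module Submission where

-- Upper bound. Call two vertices adjacent if they share an edge. If a bipartite graph between
-- neighbours of x and arbitrary vertices has average degree above a constant, it has a subgraph of
-- large minimum degree, in which x is joined greedily to some other neighbour y by t disjoint Berge
-- paths of length three. So in a theta-free hypergraph such graphs are sparse. Root a breadth-first
-- search at a vertex of a subgraph with minimum degree D: sparsity forces the second level to have
-- order D² vertices. A vertex z reached from many branches of the tree would be the other end of a
-- theta; hence every z meets boundedly many branches, sparsity inside each branch forces order D³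
-- vertices, and D³ = O(n).
--
-- Lower bound. For a prime p take three copies of F_p³ and the edges
-- {v, v + g(t), v + 3 g(t)}, one vertex in each copy, where g(t) = (t, t², t³). A Berge path of
-- length three from x to y solves α g(t₁) + β g(t₂) + γ g(t₃) = y - x, with weights determined by
-- the copies it visits. Eliminating two of the unknowns leaves a nonzero polynomial of degree at
-- most four, so each of the nine patterns contributes at most four disjoint paths.
--
-- A prime of the right order of magnitude exists by a Chebyshev-type argument.

open import Defs
open import Data.Nat using (ℕ; _≤_; NonZero)
open import Data.Nat.Properties using (m≤m+n)
open import Data.Product using (_×_; ∃-syntax)

-- The delicate point of the lower bound is that the eliminated polynomial must not vanish
-- identically. Let `I`, `A`, `B`, `J` be the copies containing `x`, `v1`, `v2`, `y`; consecutive
-- ones differ, and only three copies exist. If `B` is `I` or `A` is `J`, two consecutive weights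
-- are opposite, and the leading coefficient is nonzero unless both coincidences occur. In that case
-- the coefficient of degree two is used, since it factors into differences of parameters of
-- consecutive edges. If neither occurs, then `J` is `I` and the weights sum to zero; the
-- coefficients can then vanish only if the two eliminated parameters agree, which is false for
-- consecutive edges of a path. In the upper bound the distinctness of edges is always reduced to a
-- choice of vertices: by linearity, an edge to be avoided is the list of three vertices determined
-- by two of its points. Every obstruction to a greedy choice therefore costs boundedly many
-- vertices, and all constants depend on `t` alone.

-- Chebyshev's method: primes in intervals of bounded ratio.

module Primes where

  open import Data.Nat
  open import Data.Nat.Properties
  open import Data.Nat.Divisibility
  open import Data.Nat.Primality
  open import Data.Nat.Primality.Factorisation using (PrimeFactorisation; factorise)
  open import Data.Nat.Tactic.RingSolver using (solve-∀)
  open import Data.Nat.ListAction using (product)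
  open import Data.List using ([]; _∷_)
  open import Data.List.Relation.Unary.All using (All; []; _∷_)
  open import Data.Product using (_×_; _,_)
  open import Data.Sum using (inj₁; inj₂; [_,_]′)
  open import Function using (_∘_)
  open import Relation.Nullary using (¬_; yes; no; contradiction)
  open import Relation.Nullary.Decidable using (_×-dec_)
  open import Relation.Binary.PropositionalEquality

  -- binom i j is the binomial coefficient (i + j choose i).
  binom : ℕ → ℕ → ℕ
  binom zero    j       = 1
  binom (suc i) zero    = 1
  binom (suc i) (suc j) = binom i (suc j) + binom (suc i) j

  binom-zeroʳ : ∀ i → binom i 0 ≡ 1
  binom-zeroʳ zero    = refl
  binom-zeroʳ (suc i) = refl

  binom*!*! : ∀ i j → binom i j * (i ! * j !) ≡ (i + j) !
  binom*!*! zero j = trans (*-identityˡ _) (*-identityˡ _)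
  binom*!*! (suc i) zero = begin
    1 * (suc i ! * 1) ≡⟨ *-identityˡ _ ⟩
    suc i ! * 1       ≡⟨ *-identityʳ _ ⟩
    suc i !           ≡⟨ cong _! (+-identityʳ (suc i)) ⟨
    (suc i + 0) !     ∎
    where open ≡-Reasoning
  binom*!*! (suc i) (suc j) = begin
    (binom i (suc j) + binom (suc i) j) * ((suc i * i !) * (suc j * j !))
      ≡⟨ regroup (binom i (suc j)) (binom (suc i) j) (suc i) (i !) (suc j) (j !) ⟩
    suc i * (binom i (suc j) * (i ! * suc j !)) + suc j * (binom (suc i) j * (suc i ! * j !))
      ≡⟨ cong₂ (λ u v → suc i * u + suc j * v) (binom*!*! i (suc j))
           (trans (binom*!*! (suc i) j) (cong _! (sym (+-suc i j)))) ⟩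
    suc i * (i + suc j) ! + suc j * (i + suc j) !
      ≡⟨ *-distribʳ-+ ((i + suc j) !) (suc i) (suc j) ⟨
    (suc i + suc j) * (i + suc j) ! ∎
    where
    open ≡-Reasoning
    regroup : ∀ a b I x J y → (a + b) * ((I * x) * (J * y)) ≡ I * (a * (x * (J * y))) + J * (b * ((I * x) * y))
    regroup = solve-∀

  binom-absorbˡ : ∀ i j → suc i * binom (suc i) j ≡ (suc i + j) * binom i j
  binom-absorbˡ i j = *-cancelʳ-≡ _ _ (i ! * j !) {{i !* j !≢0}} (begin
    suc i * binom (suc i) j * (i ! * j !)     ≡⟨ regroup (suc i) (binom (suc i) j) (i !) (j !) ⟩
    binom (suc i) j * (suc i ! * j !)         ≡⟨ binom*!*! (suc i) j ⟩
    (suc i + j) * (i + j) !                   ≡⟨ cong ((suc i + j) *_) (binom*!*! i j) ⟨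
    (suc i + j) * (binom i j * (i ! * j !))   ≡⟨ *-assoc (suc i + j) (binom i j) (i ! * j !) ⟨
    (suc i + j) * binom i j * (i ! * j !)     ∎)
    where
    open ≡-Reasoning
    regroup : ∀ I b x y → I * b * (x * y) ≡ b * ((I * x) * y)
    regroup = solve-∀

  binom-absorbʳ : ∀ i j → suc j * binom i (suc j) ≡ (suc i + j) * binom i j
  binom-absorbʳ i j = *-cancelʳ-≡ _ _ (i ! * j !) {{i !* j !≢0}} (begin
    suc j * binom i (suc j) * (i ! * j !)     ≡⟨ regroup (suc j) (binom i (suc j)) (i !) (j !) ⟩
    binom i (suc j) * (i ! * suc j !)         ≡⟨ binom*!*! i (suc j) ⟩
    (i + suc j) !                             ≡⟨ cong _! (+-suc i j) ⟩
    (suc i + j) * (i + j) !                   ≡⟨ cong ((suc i + j) *_) (binom*!*! i j) ⟨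
    (suc i + j) * (binom i j * (i ! * j !))   ≡⟨ *-assoc (suc i + j) (binom i j) (i ! * j !) ⟨
    (suc i + j) * binom i j * (i ! * j !)     ∎)
    where
    open ≡-Reasoning
    regroup : ∀ I b x y → I * b * (x * y) ≡ b * (x * (I * y))
    regroup = solve-∀

  binom≤2^ : ∀ i j → binom i j ≤ 2 ^ (i + j)
  binom≤2^ zero    j       = m^n>0 2 j
  binom≤2^ (suc i) zero    = m^n>0 2 (suc i + 0)
  binom≤2^ (suc i) (suc j) = begin
    binom i (suc j) + binom (suc i) j   ≤⟨ +-mono-≤ (binom≤2^ i (suc j)) (binom≤2^ (suc i) j) ⟩
    2 ^ (i + suc j) + 2 ^ (suc i + j)   ≡⟨ cong (λ e → 2 ^ (i + suc j) + 2 ^ e) (+-suc i j) ⟨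
    2 ^ (i + suc j) + 2 ^ (i + suc j)   ≡⟨ cong (2 ^ (i + suc j) +_) (+-identityʳ _) ⟨
    2 ^ (suc i + suc j)                 ∎
    where open ≤-Reasoning

  binom-monoʳ : ∀ i j → binom i j ≤ binom i (suc j)
  binom-monoʳ zero    j = ≤-refl
  binom-monoʳ (suc i) j = m≤n+m (binom (suc i) j) (binom i (suc j))

  binom-monoˡ : ∀ i j → binom i j ≤ binom (suc i) j
  binom-monoˡ i zero    = ≤-reflexive (binom-zeroʳ i)
  binom-monoˡ i (suc j) = m≤m+n (binom i (suc j)) (binom (suc i) j)

  -- Base 2 in place of the true growth rate 4 needs only Pascal's rule and monotonicity; the loss
  -- is a constant factor in the length of the interval searched for a prime.
  2^≤central : ∀ m → 2 ^ m ≤ binom m m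
  2^≤central zero    = ≤-refl
  2^≤central (suc m) = begin
    2 ^ m + (2 ^ m + 0)               ≡⟨ cong (2 ^ m +_) (+-identityʳ _) ⟩
    2 ^ m + 2 ^ m                     ≤⟨ +-mono-≤ (2^≤central m) (2^≤central m) ⟩
    binom m m + binom m m             ≤⟨ +-mono-≤ (binom-monoʳ m m) (binom-monoˡ m m) ⟩
    binom m (suc m) + binom (suc m) m ∎
    where open ≤-Reasoning

  -- Up to the factor D, the reciprocals of i * binom i j form Leibniz' harmonic triangle,
  -- whose entries are differences of entries with smaller i.
  multiple⇒binom∣ : ∀ {N D} → (∀ {m} → .{{NonZero m}} → m ≤ N → m ∣ D) →
                    ∀ i j → suc i + j ≤ N → suc i * binom (suc i) j ∣ D
  multiple⇒binom∣ {D = D} mult zero j le =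
    subst (_∣ D) (sym (trans (binom-absorbˡ 0 j) (*-identityʳ _))) (mult le)
  multiple⇒binom∣ {N} {D} mult (suc i) j le
    with multiple⇒binom∣ mult i j (≤-trans (n≤1+n _) le)
       | multiple⇒binom∣ mult i (suc j) (subst (_≤ N) (cong suc (sym (+-suc i j))) le)
  ... | divides x D≡x | divides y D≡y = divides (x ∸ y) (*-cancelˡ-≡ D _ k (sym (begin
    k * ((x ∸ y) * (suc k * binom (suc k) j))
      ≡⟨ expand k (suc k * binom (suc k) j) (x ∸ y) ⟩
    (x ∸ y) * (k * (suc k * binom (suc k) j))
      ≡⟨ *-distribʳ-∸ (k * (suc k * binom (suc k) j)) x y ⟩
    x * (k * (suc k * binom (suc k) j)) ∸ y * (k * (suc k * binom (suc k) j))
      ≡⟨ cong₂ _∸_ fromx fromy ⟩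
    (suc k + j) * D ∸ suc j * D
      ≡⟨ *-distribʳ-∸ D (suc k + j) (suc j) ⟨
    (k + j ∸ j) * D
      ≡⟨ cong (_* D) (m+n∸n≡m k j) ⟩
    k * D ∎)))
    where
    open ≡-Reasoning
    k = suc i
    expand : ∀ k u d → k * (d * u) ≡ d * (k * u)
    expand = solve-∀
    swap : ∀ x k c b → x * (k * (c * b)) ≡ c * (x * (k * b))
    swap = solve-∀
    fromx : x * (k * (suc k * binom (suc k) j)) ≡ (suc k + j) * D
    fromx = begin
      x * (k * (suc k * binom (suc k) j)) ≡⟨ cong (λ u → x * (k * u)) (binom-absorbˡ k j) ⟩
      x * (k * ((suc k + j) * binom k j)) ≡⟨ swap x k (suc k + j) (binom k j) ⟩
      (suc k + j) * (x * (k * binom k j)) ≡⟨ cong ((suc k + j) *_) D≡x ⟨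
      (suc k + j) * D                     ∎
    fromy : y * (k * (suc k * binom (suc k) j)) ≡ suc j * D
    fromy = begin
      y * (k * (suc k * binom (suc k) j))    ≡⟨ cong (λ u → y * (k * u)) (trans (binom-absorbˡ k j) (sym (binom-absorbʳ k j))) ⟩
      y * (k * (suc j * binom k (suc j)))    ≡⟨ swap y k (suc j) (binom k (suc j)) ⟩
      suc j * (y * (k * binom k (suc j)))    ≡⟨ cong (suc j *_) D≡y ⟨
      suc j * D                              ∎

  prime>1 : ∀ {q} → Prime q → 1 < q
  prime>1 {q} qp = nonTrivial⇒n>1 q {{prime⇒nonTrivial qp}}

  prime∣⇒≡ : ∀ {p q} → Prime p → Prime q → q ∣ p → q ≡ p
  prime∣⇒≡ pp qp q∣p with prime⇒irreducible pp q∣p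
  ... | inj₁ refl = contradiction qp ¬prime[1]
  ... | inj₂ q≡p  = q≡p

  prime∤*⇒∤ : ∀ {q} m n → Prime q → ¬ q ∣ m → ¬ q ∣ n → ¬ q ∣ m * n
  prime∤*⇒∤ m n qp q∤m q∤n = [ q∤m , q∤n ]′ ∘ euclidsLemma m n qp

  prime∤1 : ∀ {q} → Prime q → ¬ q ∣ 1
  prime∤1 qp q∣1 = contradiction (subst Prime (∣1⇒≡1 q∣1) qp) ¬prime[1]

  prime∣!⇒≤ : ∀ {q} n → Prime q → q ∣ n ! → q ≤ n
  prime∣!⇒≤ zero    qp q∣ = contradiction q∣ (prime∤1 qp)
  prime∣!⇒≤ (suc n) qp q∣ with euclidsLemma (suc n) (n !) qp q∣
  ... | inj₁ q∣1+n = ∣⇒≤ q∣1+n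
  ... | inj₂ q∣n!  = ≤-trans (prime∣!⇒≤ n qp q∣n!) (n≤1+n n)

  ≤⇒∣! : ∀ {q n} → .{{NonZero q}} → q ≤ n → q ∣ n !
  ≤⇒∣! {suc q} q≤n = ∣-trans (m∣m*n (q !)) (m≤n⇒m!∣n! q≤n)

  -- The prime occurs in `(m + m) !` but in neither factor `m !`, so it survives in the quotient.
  prime∣central : ∀ {q m} → Prime q → m < q → q ≤ m + m → q ∣ binom m m
  prime∣central {q} {m} qp m<q q≤2m
    with euclidsLemma (binom m m) (m ! * m !) qp
           (subst (q ∣_) (sym (binom*!*! m m)) (≤⇒∣! {{prime⇒nonZero qp}} q≤2m))
  ... | inj₁ q∣b = q∣b
  ... | inj₂ q∣f = contradiction q∣f (prime∤*⇒∤ (m !) (m !) qp q∤ q∤)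
    where
    q∤ : ¬ q ∣ m !
    q∤ q∣ = <⇒≱ m<q (prime∣!⇒≤ m qp q∣)

  split-power : ∀ {q as} → Prime q → All Prime as → ∃[ e ] ∃[ u ] (product as ≡ q ^ e * u × ¬ q ∣ u)
  split-power qp [] = 0 , 1 , refl , prime∤1 qp
  split-power {q} {a ∷ as} qp (ap ∷ asp) with split-power qp asp | q ≟ a
  ... | e , u , eq , q∤u | yes refl = suc e , u , trans (cong (q *_) eq) (sym (*-assoc q (q ^ e) u)) , q∤u
  ... | e , u , eq , q∤u | no q≢a =
    e , a * u , trans (cong (a *_) eq) (swap a (q ^ e) u) ,
    prime∤*⇒∤ a u qp (λ q∣a → q≢a (prime∣⇒≡ ap qp q∣a)) q∤u
    where
    swap : ∀ a b c → a * (b * c) ≡ b * (a * c)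
    swap = solve-∀

  -- Induction on the factors: the tail divides `D` with some quotient `d`. The hypothesis for one
  -- more power of `q` than the tail contains forces `q` to divide `d`, which pays for the head.
  primePowers∣⇒∣ : ∀ {as D} → All Prime as → (∀ q e → Prime q → q ^ e ∣ product as → q ^ e ∣ D) → product as ∣ D
  primePowers∣⇒∣ {D = D} [] _ = 1∣ D
  primePowers∣⇒∣ {q ∷ as} {D} (qp ∷ asp) local
    with primePowers∣⇒∣ asp (λ r e rp d → local r e rp (∣n⇒∣m*n q d)) | split-power qp asp
  ... | divides d D≡ | e , u , as≡ , q∤u = subst (q * product as ∣_) (sym D≡) (*-monoˡ-∣ (product as) q∣d)
    where
    instance _ = m^n≢0 q e {{prime⇒nonZero qp}}
    regroup : ∀ x y z → x * (y * z) ≡ y * (x * z)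
    regroup = solve-∀
    q∣d*u : q ∣ d * u
    q∣d*u = *-cancelˡ-∣ (q ^ e) (subst₂ _∣_ (*-comm q (q ^ e))
      (trans D≡ (trans (cong (d *_) as≡) (regroup d (q ^ e) u)))
      (local q (suc e) qp (*-monoʳ-∣ q (subst (q ^ e ∣_) (sym as≡) (m∣m*n u)))))
    q∣d : q ∣ d
    q∣d with euclidsLemma d u qp q∣d*u
    ... | inj₁ r = r
    ... | inj₂ r = contradiction r q∤u

  ^-mono-∣ : ∀ {m n} e → m ∣ n → m ^ e ∣ n ^ e
  ^-mono-∣ zero    m∣n = ∣-refl
  ^-mono-∣ (suc e) m∣n = *-pres-∣ m∣n (^-mono-∣ e m∣n)

  ^-monoʳ-∣ : ∀ m {d e} → d ≤ e → m ^ d ∣ m ^ e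
  ^-monoʳ-∣ m {d} {e} d≤e = subst (m ^ d ∣_)
    (trans (sym (^-distribˡ-+-* m d (e ∸ d))) (cong (m ^_) (m+[n∸m]≡n d≤e))) (m∣m*n _)

  n!≤n^n : ∀ n → n ! ≤ n ^ n
  n!≤n^n zero    = ≤-refl
  n!≤n^n (suc n) = *-monoʳ-≤ (suc n) (≤-trans (n!≤n^n n) (^-monoˡ-≤ n (n≤1+n n)))

  2^suc : ∀ k → 2 ^ k + 2 ^ k ≡ 2 ^ suc k
  2^suc k = cong (2 ^ k +_) (sym (+-identityʳ _))

  -- A multiple of the product of all primes up to 2 ^ k.
  centrals : ℕ → ℕ
  centrals zero    = 1
  centrals (suc k) = binom (2 ^ k) (2 ^ k) * centrals k

  prime∣centrals : ∀ {q} k → Prime q → q ≤ 2 ^ k → q ∣ centrals k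
  prime∣centrals zero    qp q≤1 = contradiction (prime>1 qp) (≤⇒≯ q≤1)
  prime∣centrals {q} (suc k) qp q≤ with q ≤? 2 ^ k
  ... | yes q≤2^k = ∣n⇒∣m*n (binom (2 ^ k) (2 ^ k)) (prime∣centrals k qp q≤2^k)
  ... | no  q≰2^k = ∣m⇒∣m*n (centrals k)
    (prime∣central qp (≰⇒> q≰2^k) (subst (q ≤_) (sym (2^suc k)) q≤))

  -- The bound on the primorial: the factors contribute exponents 2, 4, 8, ..., a geometric series
  -- controlled by the next power of two.
  centrals≤ : ∀ k → centrals k ≤ 2 ^ (2 ^ suc k)
  centrals≤ zero    = s≤s z≤n
  centrals≤ (suc k) = begin
    binom (2 ^ k) (2 ^ k) * centrals k     ≤⟨ *-mono-≤ (binom≤2^ (2 ^ k) (2 ^ k)) (centrals≤ k) ⟩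
    2 ^ (2 ^ k + 2 ^ k) * 2 ^ (2 ^ suc k)  ≡⟨ ^-distribˡ-+-* 2 (2 ^ k + 2 ^ k) (2 ^ suc k) ⟨
    2 ^ (2 ^ k + 2 ^ k + 2 ^ suc k)        ≡⟨ cong (λ u → 2 ^ (u + 2 ^ suc k)) (2^suc k) ⟩
    2 ^ (2 ^ suc k + 2 ^ suc k)            ≡⟨ cong (2 ^_) (2^suc (suc k)) ⟩
    2 ^ (2 ^ suc (suc k))                  ∎
    where open ≤-Reasoning

  -- Source of the threshold 10 on `h`: at 9 the inequality would read 648 < 512, and from 10 on it
  -- persists.
  8*n*n<2^n : ∀ n → 8 * ((10 + n) * (10 + n)) < 2 ^ (10 + n)
  8*n*n<2^n zero    = <ᵇ⇒< 800 1024 _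
  8*n*n<2^n (suc n) = begin-strict
    8 * ((11 + n) * (11 + n))        ≤⟨ m≤m+n _ (632 + 144 * n + 8 * (n * n)) ⟩
    8 * ((11 + n) * (11 + n)) + (632 + 144 * n + 8 * (n * n)) ≡⟨ double n ⟩
    2 * (8 * ((10 + n) * (10 + n)))  <⟨ *-monoʳ-< 2 (8*n*n<2^n n) ⟩
    2 * 2 ^ (10 + n)                 ∎
    where
    open ≤-Reasoning
    double : ∀ n → 8 * ((11 + n) * (11 + n)) + (632 + 144 * n + 8 * (n * n)) ≡ 2 * (8 * ((10 + n) * (10 + n)))
    double = solve-∀

  -- If there were no prime in the interval, D = centrals k * ((2 ^ h) !) ^ (h + h) would be a
  -- multiple of every number up to 2 ^ (h + h), hence at least a central binomial coefficient.
  prime-between : ∀ k h → k + 3 ≡ h + h → 8 * (h * h) < 2 ^ h →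
                  ∃[ p ] (Prime p × 2 ^ k < p × p ≤ 2 ^ (h + h))
  prime-between k h k+3≡2h big
    with anyUpTo? (λ p → prime? p ×-dec (2 ^ k <? p)) (suc (2 ^ (h + h)))
  ... | yes (p , s≤s p≤ , pp , 2^k<p) = p , pp , 2^k<p , p≤
  ... | no none = contradiction (≤-trans (2^≤central m) central≤D) (<⇒≱ D<)
    where
    N = 2 ^ (h + h)
    -- The exponent `2 ^ suc k` in the bound for `centrals k` is half of `m`, so the other half is
    -- left for the second factor of `D`. This is why the interval has ratio 8.
    m = 2 ^ (k + 2)
    -- A prime above `2 ^ h` has square above `N`, so it occurs at most once in a number up to `N`;
    -- with no prime in the interval it is at most `2 ^ k`, and `centrals k` supplies it. A prime up
    -- to `2 ^ h` occurs with exponent at most `h + h` and is supplied by the power of the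
    -- factorial.
    D = centrals k * ((2 ^ h) !) ^ (h + h)

    m+m≡N : m + m ≡ N
    m+m≡N = trans (2^suc (k + 2)) (cong (2 ^_) (trans (sym (+-suc k 2)) k+3≡2h))

    local : ∀ {j} → j ≤ N → .{{NonZero j}} → ∀ q e → Prime q → q ^ e ∣ j → q ^ e ∣ D
    local {j} j≤N q e qp q^e∣j with q ≤? 2 ^ h
    ... | yes q≤ = ∣n⇒∣m*n (centrals k) (∣-trans (^-mono-∣ e (≤⇒∣! q≤)) (^-monoʳ-∣ ((2 ^ h) !) e≤))
      where
      instance _ = prime⇒nonZero qp
      e≤ : e ≤ h + h
      e≤ with e ≤? h + h
      ... | yes r = r
      ... | no  r = contradiction
        (≤-trans (∣⇒≤ q^e∣j) j≤N)
        (<⇒≱ (<-≤-trans (^-monoʳ-< 2 ≤-refl (≰⇒> r)) (^-monoˡ-≤ e (prime>1 qp))))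
    ... | no q≰ = go e q^e∣j
      where
      instance _ = prime⇒nonZero qp
      q≤N : ∀ e → q ^ suc e ∣ j → q ≤ N
      q≤N e d = ≤-trans (∣⇒≤ (∣-trans (m∣m*n (q ^ e)) d)) j≤N
      q≤2^k : ∀ e → q ^ suc e ∣ j → q ≤ 2 ^ k
      q≤2^k e d with q ≤? 2 ^ k
      ... | yes r = r
      ... | no  r = contradiction (q , s≤s (q≤N e d) , qp , ≰⇒> r) none
      go : ∀ e → q ^ e ∣ j → q ^ e ∣ D
      go zero          d = 1∣ D
      go (suc zero)    d = subst (_∣ D) (sym (*-identityʳ q))
        (∣m⇒∣m*n _ (prime∣centrals k qp (q≤2^k 0 d)))
      go (suc (suc e)) d = contradiction
        (≤-trans (∣⇒≤ (∣-trans (divides (q ^ e) (trans (sym (*-assoc q q (q ^ e))) (*-comm (q * q) (q ^ e)))) d)) j≤N)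
        (<⇒≱ (subst (_< q * q) (sym (^-distribˡ-+-* 2 h h)) (*-mono-< (≰⇒> q≰) (≰⇒> q≰))))

    multiple : ∀ {j} → .{{NonZero j}} → j ≤ N → j ∣ D
    multiple {j} j≤N = subst (_∣ D) (sym isFactorisation)
      (primePowers∣⇒∣ factorsPrime (λ q e qp d → local j≤N q e qp (subst (q ^ e ∣_) (sym isFactorisation) d)))
      where open PrimeFactorisation (factorise j)

    instance
      D≢0 : NonZero D
      D≢0 = m*n≢0 (centrals k) _ {{centrals≢0 k}} {{m^n≢0 ((2 ^ h) !) (h + h) {{(2 ^ h) !≢0}}}}
        where
        centrals≢0 : ∀ k → NonZero (centrals k)
        centrals≢0 zero    = _
        centrals≢0 (suc k) = m*n≢0 _ _ {{>-nonZero (<-≤-trans (m^n>0 2 (2 ^ k)) (2^≤central (2 ^ k)))}} {{centrals≢0 k}}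

    central∣D : ∀ i → i + i ≤ N → binom i i ∣ D
    central∣D zero    le = 1∣ D
    central∣D (suc i) le = ∣-trans (n∣m*n (suc i)) (multiple⇒binom∣ multiple i (suc i) le)

    central≤D : binom m m ≤ D
    central≤D = ∣⇒≤ (central∣D m (≤-reflexive m+m≡N))

    open ≤-Reasoning

    D≤ : D ≤ 2 ^ (2 ^ suc k + h * 2 ^ h * (h + h))
    D≤ = begin
      centrals k * ((2 ^ h) !) ^ (h + h)
        ≤⟨ *-mono-≤ (centrals≤ k) (^-monoˡ-≤ (h + h) (n!≤n^n (2 ^ h))) ⟩
      2 ^ (2 ^ suc k) * ((2 ^ h) ^ (2 ^ h)) ^ (h + h)
        ≡⟨ cong (2 ^ (2 ^ suc k) *_) (trans (cong (_^ (h + h)) (^-*-assoc 2 h (2 ^ h))) (^-*-assoc 2 (h * 2 ^ h) (h + h))) ⟩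
      2 ^ (2 ^ suc k) * 2 ^ (h * 2 ^ h * (h + h))
        ≡⟨ ^-distribˡ-+-* 2 (2 ^ suc k) _ ⟨
      2 ^ (2 ^ suc k + h * 2 ^ h * (h + h)) ∎

    -- The small primes cost an exponent of order the square root of `N`, up to the factor `h * h`;
    -- `big` says precisely that this stays below `2 ^ suc k`.
    small : h * 2 ^ h * (h + h) < 2 ^ suc k
    small = *-cancelˡ-< 4 _ _ (begin-strict
      4 * (h * 2 ^ h * (h + h))  ≡⟨ regroup h (2 ^ h) ⟩
      2 ^ h * (8 * (h * h))      <⟨ *-monoʳ-< (2 ^ h) {{m^n≢0 2 h}} big ⟩
      2 ^ h * 2 ^ h              ≡⟨ ^-distribˡ-+-* 2 h h ⟨
      2 ^ (h + h)                ≡⟨ cong (2 ^_) (trans (sym k+3≡2h) (+-comm k 3)) ⟩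
      2 ^ (3 + k)                ≡⟨ ^-distribˡ-+-* 2 2 (suc k) ⟩
      4 * 2 ^ suc k              ∎)
      where
      regroup : ∀ h s → 4 * (h * s * (h + h)) ≡ s * (8 * (h * h))
      regroup = solve-∀

    D< : D < 2 ^ m
    D< = begin-strict
      D                                     ≤⟨ D≤ ⟩
      2 ^ (2 ^ suc k + h * 2 ^ h * (h + h)) <⟨ ^-monoʳ-< 2 ≤-refl (+-monoʳ-< (2 ^ suc k) small) ⟩
      2 ^ (2 ^ suc k + 2 ^ suc k)           ≡⟨ cong (2 ^_) (2^suc (suc k)) ⟩
      2 ^ (2 ^ suc (suc k))                 ≡⟨ cong (λ u → 2 ^ (2 ^ u)) (+-comm 2 k) ⟩
      2 ^ m                                 ∎

-- Counting in lists without repetitions, and pruning of bipartite graphs.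

module Counting where

  open import Data.Nat
  open import Data.Nat.Properties
  open import Data.Nat.Tactic.RingSolver using (solve-∀)
  open import Data.Bool using (true; false; if_then_else_)
  open import Data.List using (List; []; _∷_; _++_; length; filter; map)
  open import Data.List.Properties using (length-++; length-map)
  open import Data.List.Membership.Propositional using (_∈_; _∉_; find; lose)
  open import Data.List.Membership.Propositional.Properties using (∈-filter⁺; ∈-filter⁻; ∈-++⁺ˡ; ∈-++⁺ʳ; ∈-map⁺)
  open import Data.List.Relation.Unary.Any using (here; there; any?; _─_)
  open import Data.List.Relation.Unary.All as All using (All; []; _∷_)
  open import Data.List.Relation.Unary.All.Properties using () renaming (─⁺ to All-─⁺)
  open import Data.List.Relation.Unary.AllPairs using ([]; _∷_)
  open import Data.List.Relation.Unary.Unique.Propositional using (Unique)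
  import Data.List.Relation.Unary.Unique.Propositional.Properties as Unique
  import Data.List.Membership.DecPropositional as DecMembership
  open import Data.Product using (_×_; _,_; proj₁; proj₂)
  open import Function using (_∘_; id)
  open import Relation.Nullary using (¬_; Dec; yes; no; does; contradiction)
  open import Relation.Nullary.Decidable using (¬?; decidable-stable)
  open import Relation.Unary using (Decidable)
  open import Relation.Binary using (DecidableEquality)
  open import Relation.Binary.PropositionalEquality

  private variable
    X Y : Set

  length-─ : ∀ {x} {xs : List X} (p : x ∈ xs) → length xs ≡ suc (length (xs ─ p))
  length-─ (here _)  = refl
  length-─ {xs = _ ∷ _} (there p) = cong suc (length-─ p)

  ∈-─⁺ : ∀ {x y} {xs : List X} (p : x ∈ xs) → y ∈ xs → y ≢ x → y ∈ (xs ─ p)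
  ∈-─⁺ (here refl) (here y≡x)  y≢x = contradiction y≡x y≢x
  ∈-─⁺ (here refl) (there q)   y≢x = q
  ∈-─⁺ (there p)   (here refl) y≢x = here refl
  ∈-─⁺ (there p)   (there q)   y≢x = there (∈-─⁺ p q y≢x)

  ∈-─⁻ : ∀ {x y} {xs : List X} (p : x ∈ xs) → y ∈ (xs ─ p) → y ∈ xs
  ∈-─⁻ (here _)  q           = there q
  ∈-─⁻ {xs = _ ∷ _} (there p) (here refl) = here refl
  ∈-─⁻ {xs = _ ∷ _} (there p) (there q)   = there (∈-─⁻ p q)

  Unique-─ : ∀ {x} {xs : List X} (p : x ∈ xs) → Unique xs → Unique (xs ─ p)
  Unique-─ (here _)  (_ ∷ u)  = u
  Unique-─ (there p) (x∉ ∷ u) = All-─⁺ p x∉ ∷ Unique-─ p u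

  -- Two elements of `xs` never share a partner, so partners can be chosen one after another without
  -- conflict: the partner of the head is deleted from `ys`, and no later element needs it.
  matching⇒length≤ : (R : X → Y → Set) → (∀ {x x′ y} → R x y → R x′ y → x ≡ x′) →
                     ∀ {xs ys} → Unique xs → (∀ {x} → x ∈ xs → ∃[ y ] (y ∈ ys × R x y)) →
                     length xs ≤ length ys
  matching⇒length≤ R inj [] _ = z≤n
  matching⇒length≤ R inj {x ∷ xs} {ys} (x∉ ∷ u) match with match (here refl)
  ... | y , p , xRy = subst (suc (length xs) ≤_) (sym (length-─ p))
    (s≤s (matching⇒length≤ R inj u rest))
    where
    rest : ∀ {x′} → x′ ∈ xs → ∃[ y′ ] (y′ ∈ (ys ─ p) × R x′ y′)
    rest q with match (there q)
    ... | y′ , p′ , r = y′ , ∈-─⁺ p p′ (λ { refl → All.lookup x∉ q (inj xRy r) }) , r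

  Unique⊆⇒length≤ : ∀ {xs ys : List X} → Unique xs → (∀ {x} → x ∈ xs → x ∈ ys) → length xs ≤ length ys
  Unique⊆⇒length≤ u sub = matching⇒length≤ _≡_ (λ p q → trans p (sym q)) u (λ p → _ , sub p , refl)

  avoid : DecidableEquality X → ∀ {xs : List X} ys → Unique xs → length ys < length xs →
          ∃[ x ] (x ∈ xs × x ∉ ys)
  avoid _≟ˣ_ {xs} ys u lt with any? (λ x → ¬? (x ∈? ys)) xs
    where open DecMembership _≟ˣ_ using (_∈?_)
  ... | yes p = find p
  ... | no ¬p = contradiction (Unique⊆⇒length≤ u all∈) (<⇒≱ lt)
    where
    open DecMembership _≟ˣ_ using (_∈?_)
    all∈ : ∀ {x} → x ∈ xs → x ∈ ys
    all∈ {x} q = decidable-stable (x ∈? ys) (λ x∉ → ¬p (lose q x∉))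

  sumOver : List X → (X → ℕ) → ℕ
  sumOver []       f = 0
  sumOver (x ∷ xs) f = f x + sumOver xs f

  sumOver-─ : ∀ {x} {xs : List X} f (p : x ∈ xs) → sumOver xs f ≡ f x + sumOver (xs ─ p) f
  sumOver-─ f (here refl) = refl
  sumOver-─ {x = x} {y ∷ xs} f (there p) =
    trans (cong (f y +_) (sumOver-─ f p)) (swap (f y) (f x) (sumOver (xs ─ p) f))
    where
    swap : ∀ a b c → a + (b + c) ≡ b + (a + c)
    swap = solve-∀

  sumOver-mono : ∀ (xs : List X) {f g} → (∀ {x} → x ∈ xs → f x ≤ g x) → sumOver xs f ≤ sumOver xs g
  sumOver-mono []       le = z≤n
  sumOver-mono (x ∷ xs) le = +-mono-≤ (le (here refl)) (sumOver-mono xs (le ∘ there))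

  sumOver-const : ∀ (xs : List X) c → sumOver xs (λ _ → c) ≡ length xs * c
  sumOver-const []       c = refl
  sumOver-const (x ∷ xs) c = cong (c +_) (sumOver-const xs c)

  sumOver-* : ∀ (xs : List X) c f → sumOver xs (λ x → c * f x) ≡ c * sumOver xs f
  sumOver-* []       c f = sym (*-zeroʳ c)
  sumOver-* (x ∷ xs) c f = trans (cong (c * f x +_) (sumOver-* xs c f)) (sym (*-distribˡ-+ c (f x) _))

  sumOver-+ : ∀ (xs : List X) f g → sumOver xs (λ x → f x + g x) ≡ sumOver xs f + sumOver xs g
  sumOver-+ []       f g = refl
  sumOver-+ (x ∷ xs) f g = trans (cong (f x + g x +_) (sumOver-+ xs f g)) (swap (f x) (g x) _ _)
    where
    swap : ∀ a b c d → a + b + (c + d) ≡ a + c + (b + d)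
    swap = solve-∀

  sumOver-swap : ∀ (xs : List X) (ys : List Y) (f : X → Y → ℕ) →
                 sumOver xs (λ x → sumOver ys (f x)) ≡ sumOver ys (λ y → sumOver xs (λ x → f x y))
  sumOver-swap []       ys f = sym (trans (sumOver-const ys 0) (*-zeroʳ (length ys)))
  sumOver-swap (x ∷ xs) ys f =
    trans (cong (sumOver ys (f x) +_) (sumOver-swap xs ys f)) (sym (sumOver-+ ys (f x) _))

  indicator : ∀ {P : Set} → Dec P → ℕ
  indicator d = if does d then 1 else 0

  count : ∀ {P : X → Set} → Decidable P → List X → ℕ
  count P? xs = sumOver xs (indicator ∘ P?)

  length-filter≡count : ∀ {P : X → Set} (P? : Decidable P) xs → length (filter P? xs) ≡ count P? xs
  length-filter≡count P? []       = refl
  length-filter≡count P? (x ∷ xs) with does (P? x)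
  ... | true  = cong suc (length-filter≡count P? xs)
  ... | false = length-filter≡count P? xs

  count-avoid : DecidableEquality X → ∀ {P : X → Set} (P? : Decidable P) {xs} ys → Unique xs →
                length ys < count P? xs → ∃[ x ] (x ∈ xs × P x × x ∉ ys)
  count-avoid _≟ˣ_ P? {xs} ys u lt
    with avoid _≟ˣ_ ys (Unique.filter⁺ P? u) (subst (length ys <_) (sym (length-filter≡count P? xs)) lt)
  ... | x , x∈ , x∉ys = x , proj₁ (∈-filter⁻ P? {xs = xs} x∈) , proj₂ (∈-filter⁻ P? {xs = xs} x∈) , x∉ys

  count>0⇒∃ : ∀ {P : X → Set} (P? : Decidable P) xs → 0 < count P? xs → ∃[ x ] (x ∈ xs × P x)
  count>0⇒∃ P? (x ∷ xs) lt with P? x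
  ... | yes px = x , here refl , px
  ... | no _ with count>0⇒∃ P? xs lt
  ...   | y , y∈ , py = y , there y∈ , py

  member⇒count>0 : ∀ {P : X → Set} (P? : Decidable P) {x xs} → x ∈ xs → P x → 1 ≤ count P? xs
  member⇒count>0 P? {x} {xs} x∈ px = subst (1 ≤_) (length-filter≡count P? xs)
    (Unique⊆⇒length≤ {xs = x ∷ []} ([] ∷ []) (λ { (here refl) → ∈-filter⁺ P? x∈ px }))

  -- Degree bookkeeping for the breadth-first search: on restricting to the next level, a vertex
  -- loses only neighbours in the exceptional list `ys`.
  count-≤-filter : DecidableEquality X → ∀ {P P′ Q : X → Set}
                   (P? : Decidable P) (P′? : Decidable P′) (Q? : Decidable Q) {xs} ys → Unique xs →
                   (∀ {x} → x ∈ xs → P x → x ∉ ys → P′ x × Q x) →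
                   count P? xs ≤ count P′? (filter Q? xs) + length ys
  count-≤-filter _≟ˣ_ P? P′? Q? {xs} ys u imp = subst₂ _≤_
    (length-filter≡count P? xs)
    (trans (length-++ (filter P′? (filter Q? xs)))
           (cong (_+ length ys) (length-filter≡count P′? (filter Q? xs))))
    (Unique⊆⇒length≤ (Unique.filter⁺ P? u) sub)
    where
    open DecMembership _≟ˣ_ using (_∈?_)
    sub : ∀ {x} → x ∈ filter P? xs → x ∈ filter P′? (filter Q? xs) ++ ys
    sub {x} x∈ with x ∈? ys
    ... | yes x∈ys = ∈-++⁺ʳ (filter P′? (filter Q? xs)) x∈ys
    ... | no  x∉ys with ∈-filter⁻ P? {xs = xs} x∈
    ...   | x∈xs , px with imp x∈xs px x∉ys
    ...     | p′x , qx = ∈-++⁺ˡ (∈-filter⁺ P′? (∈-filter⁺ Q? x∈xs qx) p′x)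

  module Bipartite {X Y : Set} {A : X → Y → Set} (A? : ∀ x y → Dec (A x y)) where

    edgeCount : List X → List Y → ℕ
    edgeCount L R = sumOver L (λ x → count (A? x) R)

    edgeCount-flip : ∀ L R → edgeCount L R ≡ sumOver R (λ y → count (λ x → A? x y) L)
    edgeCount-flip L R = sumOver-swap L R (λ x y → indicator (A? x y))

    pairs : List X → List Y → List (X × Y)
    pairs []      R = []
    pairs (x ∷ L) R = map (x ,_) (filter (A? x) R) ++ pairs L R

    length-pairs : ∀ L R → length (pairs L R) ≡ edgeCount L R
    length-pairs []      R = refl
    length-pairs (x ∷ L) R = begin
      length (map (x ,_) (filter (A? x) R) ++ pairs L R) ≡⟨ length-++ (map (x ,_) (filter (A? x) R)) ⟩
      length (map (x ,_) (filter (A? x) R)) + length (pairs L R)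
        ≡⟨ cong₂ _+_ (trans (length-map (x ,_) (filter (A? x) R)) (length-filter≡count (A? x) R)) (length-pairs L R) ⟩
      count (A? x) R + edgeCount L R ∎
      where open ≡-Reasoning

    ∈-pairs : ∀ {L R x y} → x ∈ L → y ∈ R → A x y → (x , y) ∈ pairs L R
    ∈-pairs {x ∷ L} (here refl) y∈ a = ∈-++⁺ˡ (∈-map⁺ (x ,_) (∈-filter⁺ (A? x) y∈ a))
    ∈-pairs {x′ ∷ L} {R} (there x∈) y∈ a = ∈-++⁺ʳ (map (x′ ,_) (filter (A? x′) R)) (∈-pairs x∈ y∈ a)

    -- The `root` makes the subgraph nonempty; without it, two empty lists would satisfy the degree
    -- conditions.
    record Core (δ : ℕ) (L : List X) (R : List Y) : Set where
      field
        left       : List X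
        right      : List Y
        left⊆      : ∀ {x} → x ∈ left → x ∈ L
        right⊆     : ∀ {y} → y ∈ right → y ∈ R
        leftUnique  : Unique left
        rightUnique : Unique right
        leftDeg    : ∀ {x} → x ∈ left → δ < count (A? x) right
        rightDeg   : ∀ {y} → y ∈ right → δ < count (λ x → A? x y) left
        root       : X
        root∈      : root ∈ left

    private
      -- The density inequality survives a deletion: one vertex fewer lowers the left side by `δ`,
      -- and the number of edges drops by at most `δ`.
      shrink : ∀ {δ e e′ d s} → δ * suc s < e → e ≡ d + e′ → ¬ δ < d → δ * s < e′
      shrink {δ} {e} {e′} {d} {s} lt refl δ≮d = +-cancelˡ-< δ _ _ (begin-strict
        δ + δ * s ≡⟨ *-suc δ s ⟨
        δ * suc s <⟨ lt ⟩
        d + e′    ≤⟨ +-monoˡ-≤ e′ (≮⇒≥ δ≮d) ⟩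
        δ + e′    ∎)
        where open ≤-Reasoning

      -- Vertices of degree at most δ are deleted one by one; k bounds the number of deletions.
      prune : ∀ k {δ L R} → length L + length R ≤ k → Unique L → Unique R →
              δ * (length L + length R) < edgeCount L R → Core δ L R
      prune k {δ} {L} {R} _ uL uR lt
        with any? (λ x → ¬? (δ <? count (A? x) R)) L
           | any? (λ y → ¬? (δ <? count (λ x → A? x y) L)) R
      prune zero {δ} {x ∷ L} () uL uR lt | yes _ | _
      prune zero {δ} {[]} {_ ∷ R} () uL uR lt | _ | yes _
      prune (suc k) {δ} {L} {R} le uL uR lt | yes bad | _ with find bad
      ... | x , x∈L , δ≮ = record
        { left = left ; right = right ; left⊆ = ∈-─⁻ x∈L ∘ left⊆ ; right⊆ = right⊆
        ; leftUnique = leftUnique ; rightUnique = rightUnique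
        ; leftDeg = leftDeg ; rightDeg = rightDeg ; root = root ; root∈ = root∈ }
        where
        size : length L + length R ≡ suc (length (L ─ x∈L) + length R)
        size = cong (_+ length R) (length-─ x∈L)
        open Core (prune k {δ} {L ─ x∈L} {R} (≤-pred (subst (_≤ suc k) size le)) (Unique-─ x∈L uL) uR
          (shrink (subst (λ s → δ * s < edgeCount L R) size lt) (sumOver-─ _ x∈L) δ≮))
      prune (suc k) {δ} {L} {R} le uL uR lt | no _ | yes bad with find bad
      ... | y , y∈R , δ≮ = record
        { left = left ; right = right ; left⊆ = left⊆ ; right⊆ = ∈-─⁻ y∈R ∘ right⊆
        ; leftUnique = leftUnique ; rightUnique = rightUnique
        ; leftDeg = leftDeg ; rightDeg = rightDeg ; root = root ; root∈ = root∈ }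
        where
        size : length L + length R ≡ suc (length L + length (R ─ y∈R))
        size = trans (cong (length L +_) (length-─ y∈R)) (+-suc (length L) _)
        removed : edgeCount L R ≡ count (λ x → A? x y) L + edgeCount L (R ─ y∈R)
        removed = trans (edgeCount-flip L R) (trans (sumOver-─ _ y∈R)
          (cong (count (λ x → A? x y) L +_) (sym (edgeCount-flip L (R ─ y∈R)))))
        open Core (prune k {δ} {L} {R ─ y∈R} (≤-pred (subst (_≤ suc k) size le)) uL (Unique-─ y∈R uR)
          (shrink (subst (λ s → δ * s < edgeCount L R) size lt) removed δ≮))
      prune k {δ} {[]} {R} le uL uR lt | no ¬l | no ¬r = contradiction lt n≮0
      prune k {δ} {x ∷ L} {R} le uL uR lt | no ¬l | no ¬r = record
        { left = x ∷ L ; right = R ; left⊆ = id ; right⊆ = id ; leftUnique = uL ; rightUnique = uR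
        ; leftDeg = λ {x} x∈ → decidable-stable (δ <? count (A? x) R) (¬l ∘ lose x∈)
        ; rightDeg = λ {y} y∈ → decidable-stable (δ <? count (λ z → A? z y) (x ∷ L)) (¬r ∘ lose y∈)
        ; root = x ; root∈ = here refl }

    core : ∀ δ {L R} → Unique L → Unique R → δ * (length L + length R) < edgeCount L R → Core δ L R
    core δ uL uR lt = prune _ ≤-refl uL uR lt

-- Greedy construction of thetas, and the breadth-first search in a theta-free hypergraph.

module ThetaPaths where

  open Counting
  open import Data.Nat
  open import Data.Nat.Properties
  open import Data.Nat.Tactic.RingSolver using (solve-∀)
  open import Data.Fin as Fin using (Fin; zero; suc)
  open import Data.Fin.Properties as Fin using ()
  open import Data.Fin.Subset as Subset using (Subset; inside; outside; ∣_∣)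
  open import Data.Fin.Subset.Properties as Subset using (x∈p∩q⁺)
  open import Data.Vec using ([]; _∷_)
  import Data.Vec as Vec
  import Data.Vec.Properties as Vec
  import Data.Bool.Properties as Bool
  open import Data.List using (List; []; _∷_; _++_; length; filter; map; tabulate; allFin)
  open import Data.List.Properties using (length-++; length-map; length-tabulate)
  open import Data.List.Membership.Propositional using (_∈_; _∉_; find; lose)
  open import Data.List.Membership.Propositional.Properties using (∈-filter⁻; ∈-++⁺ˡ; ∈-++⁺ʳ; ∈-++⁻; ∈-map⁺; ∈-map⁻; ∈-tabulate⁻; ∈-allFin)
  open import Data.List.Relation.Unary.Any using (Any; here; there; any?)
  open import Data.List.Relation.Unary.All as All using (All; []; _∷_)
  import Data.List.Relation.Unary.All.Properties as All
  open import Data.List.Relation.Unary.AllPairs using ([]; _∷_)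
  open import Data.List.Relation.Unary.Unique.Propositional using (Unique)
  import Data.List.Relation.Unary.Unique.Propositional.Properties as Unique
  open import Data.Product using (_×_; _,_; proj₁; proj₂)
  open import Data.Sum using ([_,_]′)
  open import Function using (_∘_)
  open import Relation.Nullary using (¬_; Dec; yes; no; contradiction)
  open import Relation.Nullary.Decidable using (_×-dec_; ¬?)
  open import Relation.Binary.PropositionalEquality

  private variable
    n : ℕ

  elems : Subset n → List (Fin n)
  elems []            = []
  elems (inside  ∷ p) = zero ∷ map suc (elems p)
  elems (outside ∷ p) = map suc (elems p)

  ∈-elems⁺ : ∀ {p : Subset n} {x} → x Subset.∈ p → x ∈ elems p
  ∈-elems⁺ {p = inside  ∷ p} {zero}  _  = here refl
  ∈-elems⁺ {p = inside  ∷ p} {suc x} (Vec.there x∈) = there (∈-map⁺ suc (∈-elems⁺ x∈))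
  ∈-elems⁺ {p = outside ∷ p} {suc x} (Vec.there x∈) = ∈-map⁺ suc (∈-elems⁺ x∈)

  ∈-elems⁻ : ∀ {p : Subset n} {x} → x ∈ elems p → x Subset.∈ p
  ∈-elems⁻ {p = inside  ∷ p} (here refl) = Vec.here
  ∈-elems⁻ {p = inside  ∷ p} (there x∈) with ∈-map⁻ suc x∈
  ... | _ , y∈ , refl = Vec.there (∈-elems⁻ y∈)
  ∈-elems⁻ {p = outside ∷ p} x∈ with ∈-map⁻ suc x∈
  ... | _ , y∈ , refl = Vec.there (∈-elems⁻ y∈)

  length-elems : ∀ (p : Subset n) → length (elems p) ≡ ∣ p ∣
  length-elems []            = refl
  length-elems (inside  ∷ p) = cong suc (trans (length-map suc (elems p)) (length-elems p))
  length-elems (outside ∷ p) = trans (length-map suc (elems p)) (length-elems p)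

  Unique-elems : ∀ (p : Subset n) → Unique (elems p)
  Unique-elems []            = []
  Unique-elems (inside  ∷ p) =
    All.map⁺ (All.tabulate (λ _ ())) ∷ Unique.map⁺ Fin.suc-injective (Unique-elems p)
  Unique-elems (outside ∷ p) = Unique.map⁺ Fin.suc-injective (Unique-elems p)

  ∣p∣>1⇒∃≢ : ∀ {p : Subset n} → 2 ≤ ∣ p ∣ → ∃[ u ] ∃[ v ] (u Subset.∈ p × v Subset.∈ p × u ≢ v)
  ∣p∣>1⇒∃≢ {p = p} 2≤ with elems p in eq | Unique-elems p | length-elems p
  ... | []        | _                | ∣p∣≡ = contradiction 2≤ (<⇒≱ (subst (_< 2) ∣p∣≡ z<s))
  ... | _ ∷ []    | _                | ∣p∣≡ = contradiction 2≤ (<⇒≱ (subst (_< 2) ∣p∣≡ (s<s z<s)))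
  ... | u ∷ v ∷ _ | ((u≢v ∷ _) ∷ _) | _    =
    u , v , ∈-elems⁻ (subst (u ∈_) (sym eq) (here refl)) ,
    ∈-elems⁻ (subst (v ∈_) (sym eq) (there (here refl))) , u≢v

  ∃≢⇒∣p∣>1 : ∀ {p : Subset n} {u v} → u Subset.∈ p → v Subset.∈ p → u ≢ v → 2 ≤ ∣ p ∣
  ∃≢⇒∣p∣>1 {p = p} {u} {v} u∈ v∈ u≢v = subst (2 ≤_) (length-elems p)
    (Unique⊆⇒length≤ {xs = u ∷ v ∷ []} ((u≢v ∷ []) ∷ [] ∷ [])
      λ { (here refl) → ∈-elems⁺ u∈ ; (there (here refl)) → ∈-elems⁺ v∈ })

  module Upper {n : ℕ} (H : Hypergraph3 n) (linear : Linear H) where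

    open import Data.List.Membership.DecPropositional (Fin._≟_ {n}) using (_∈?_; _∉?_)

    private
      V = Fin n
      E = edges H

    linear-≡ : ∀ {e f u v} → e ∈ E → f ∈ E → u ≢ v → u Subset.∈ e → v Subset.∈ e →
               u Subset.∈ f → v Subset.∈ f → e ≡ f
    linear-≡ {e} {f} e∈ f∈ u≢v ue ve uf vf with Vec.≡-dec Bool._≟_ e f
    ... | yes e≡f = e≡f
    ... | no  e≢f = contradiction (linear e∈ f∈ e≢f)
      (<⇒≱ (∃≢⇒∣p∣>1 (x∈p∩q⁺ (ue , uf)) (x∈p∩q⁺ (ve , vf)) u≢v))

    Joins : V → V → Subset n → Set
    Joins u v e = u Subset.∈ e × v Subset.∈ e

    joins? : ∀ u v e → Dec (Joins u v e)
    joins? u v e = u Subset.∈? e ×-dec v Subset.∈? e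

    -- The vertices of the edge through u and v; empty if there is no such edge.
    span : V → V → List V
    span u v with any? (joins? u v) E
    ... | yes p = elems (proj₁ (find p))
    ... | no  _ = []

    length-span : ∀ u v → length (span u v) ≤ 3
    length-span u v with any? (joins? u v) E
    ... | yes p = ≤-reflexive (trans (length-elems (proj₁ (find p)))
                                     (All.lookup (uniform H) (proj₁ (proj₂ (find p)))))
    ... | no  _ = z≤n

    ∈-span : ∀ {u v w e} → e ∈ E → u ≢ v → u Subset.∈ e → v Subset.∈ e → w Subset.∈ e → w ∈ span u v
    ∈-span {u} {v} e∈ u≢v ue ve we with any? (joins? u v) E
    ... | no ¬p = contradiction (lose e∈ (ue , ve)) ¬p
    ... | yes p with find p
    ...   | f , f∈ , uf , vf with linear-≡ e∈ f∈ u≢v ue ve uf vf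
    ...     | refl = ∈-elems⁺ we

    Adj : V → V → Set
    Adj u v = u ≢ v × Any (Joins u v) E

    adj? : ∀ u v → Dec (Adj u v)
    adj? u v = ¬? (u Fin.≟ v) ×-dec any? (joins? u v) E

    Adj-sym : ∀ {u v} → Adj u v → Adj v u
    Adj-sym (u≢v , p) with find p
    ... | e , e∈ , ue , ve = u≢v ∘ sym , lose e∈ (ve , ue)

    open Bipartite adj? public

    -- These are the conditions that a theta imposes on one of its paths, apart from `x ≢ y`; the
    -- conditions between different paths form `Compatible`.
    record Path (x y : V) : Set where
      field
        v1 v2    : V
        e1 e2 e3 : Subset n
        e1∈ : e1 ∈ E
        e2∈ : e2 ∈ E
        e3∈ : e3 ∈ E
        x∈e1  : x  Subset.∈ e1
        v1∈e1 : v1 Subset.∈ e1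
        v1∈e2 : v1 Subset.∈ e2
        v2∈e2 : v2 Subset.∈ e2
        v2∈e3 : v2 Subset.∈ e3
        y∈e3  : y  Subset.∈ e3
        x≢v1  : x ≢ v1
        x≢v2  : x ≢ v2
        y≢v1  : y ≢ v1
        y≢v2  : y ≢ v2
        v1≢v2 : v1 ≢ v2
        e1≢e2 : e1 ≢ e2
        e1≢e3 : e1 ≢ e3
        e2≢e3 : e2 ≢ e3

    footprint : ∀ {x y} → Path x y → List V
    footprint P = elems e1 ++ elems e2 ++ elems e3
      where open Path P

    length-footprint : ∀ {x y} (P : Path x y) → length (footprint P) ≡ 9
    length-footprint P = trans (length-++ (elems e1)) (cong₂ _+_ (three e1∈)
      (trans (length-++ (elems e2)) (cong₂ _+_ (three e2∈) (three e3∈))))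
      where
      open Path P
      three : ∀ {e} → e ∈ E → length (elems e) ≡ 3
      three {e} e∈ = trans (length-elems e) (All.lookup (uniform H) e∈)

    Avoids : ∀ {x y} → Path x y → List V → Set
    Avoids P F = v1 ∉ F × v2 ∉ F
      where open Path P

    record Compatible {x y : V} (P Q : Path x y) : Set where
      private
        module P = Path P
        module Q = Path Q
      field
        v11 : P.v1 ≢ Q.v1
        v12 : P.v1 ≢ Q.v2
        v21 : P.v2 ≢ Q.v1
        v22 : P.v2 ≢ Q.v2
        e11 : P.e1 ≢ Q.e1
        e12 : P.e1 ≢ Q.e2
        e13 : P.e1 ≢ Q.e3
        e21 : P.e2 ≢ Q.e1
        e22 : P.e2 ≢ Q.e2
        e23 : P.e2 ≢ Q.e3
        e31 : P.e3 ≢ Q.e1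
        e32 : P.e3 ≢ Q.e2
        e33 : P.e3 ≢ Q.e3

    Compatible-sym : ∀ {x y} {P Q : Path x y} → Compatible P Q → Compatible Q P
    Compatible-sym c = record
      { v11 = v11 ∘ sym ; v12 = v21 ∘ sym ; v21 = v12 ∘ sym ; v22 = v22 ∘ sym
      ; e11 = e11 ∘ sym ; e12 = e21 ∘ sym ; e13 = e31 ∘ sym
      ; e21 = e12 ∘ sym ; e22 = e22 ∘ sym ; e23 = e32 ∘ sym
      ; e31 = e13 ∘ sym ; e32 = e23 ∘ sym ; e33 = e33 ∘ sym }
      where open Compatible c

    -- Each edge of `P` contains an inner vertex of `P`, and the footprint of `Q` contains every
    -- vertex of the edges of `Q`. Hence avoidance by the two inner vertices alone already separates
    -- the edges.
    avoids⇒compatible : ∀ {x y} (P Q : Path x y) → Avoids P (footprint Q) → Compatible P Q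
    avoids⇒compatible P Q (v1∉ , v2∉) = record
      { v11 = λ { refl → v1∉ (in1 Q.v1∈e1) } ; v12 = λ { refl → v1∉ (in2 Q.v2∈e2) }
      ; v21 = λ { refl → v2∉ (in1 Q.v1∈e1) } ; v22 = λ { refl → v2∉ (in2 Q.v2∈e2) }
      ; e11 = λ { refl → v1∉ (in1 P.v1∈e1) } ; e12 = λ { refl → v1∉ (in2 P.v1∈e1) } ; e13 = λ { refl → v1∉ (in3 P.v1∈e1) }
      ; e21 = λ { refl → v1∉ (in1 P.v1∈e2) } ; e22 = λ { refl → v1∉ (in2 P.v1∈e2) } ; e23 = λ { refl → v1∉ (in3 P.v1∈e2) }
      ; e31 = λ { refl → v2∉ (in1 P.v2∈e3) } ; e32 = λ { refl → v2∉ (in2 P.v2∈e3) } ; e33 = λ { refl → v2∉ (in3 P.v2∈e3) } }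
      where
      module P = Path P
      module Q = Path Q
      in1 : ∀ {v} → v Subset.∈ Q.e1 → v ∈ footprint Q
      in1 v∈ = ∈-++⁺ˡ (∈-elems⁺ v∈)
      in2 : ∀ {v} → v Subset.∈ Q.e2 → v ∈ footprint Q
      in2 v∈ = ∈-++⁺ʳ (elems Q.e1) (∈-++⁺ˡ (∈-elems⁺ v∈))
      in3 : ∀ {v} → v Subset.∈ Q.e3 → v ∈ footprint Q
      in3 v∈ = ∈-++⁺ʳ (elems Q.e1) (∈-++⁺ʳ (elems Q.e2) (∈-elems⁺ v∈))

    PathsAvoiding : ℕ → V → V → Set
    PathsAvoiding m x y = ∀ F → length F ≤ m → ∃[ P ] Avoids {x} {y} P F

    record PathFamily (k : ℕ) (x y : V) : Set where
      field
        path       : Fin k → Path x y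
        compatible : ∀ {i j} → i ≢ j → Compatible (path i) (path j)
        used       : List V
        length-used : length used ≡ k * 9
        footprint⊆ : ∀ i {v} → v ∈ footprint (path i) → v ∈ used

    -- Each chosen path blocks nine vertices, three on each of its three edges, so the blocked list
    -- never outgrows `t * 9`.
    greedy : ∀ {x y} t → PathsAvoiding (t * 9) x y → ∀ k → k ≤ t → PathFamily k x y
    greedy t avoiding zero    k≤t = record
      { path = λ () ; compatible = λ { {()} } ; used = [] ; length-used = refl ; footprint⊆ = λ () }
    greedy {x} {y} t avoiding (suc k) k≤t = extend (greedy t avoiding k (<⇒≤ k≤t))
      where
      extend : PathFamily k x y → PathFamily (suc k) x y
      extend fam = record
        { path = path′ ; compatible = compatible′ ; used = footprint P ++ used
        ; length-used = trans (length-++ (footprint P)) (cong₂ _+_ (length-footprint P) length-used)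
        ; footprint⊆ = λ { zero v∈ → ∈-++⁺ˡ v∈ ; (suc i) v∈ → ∈-++⁺ʳ (footprint P) (footprint⊆ i v∈) } }
        where
        open PathFamily fam
        new = avoiding used (subst (_≤ t * 9) (sym length-used) (*-monoˡ-≤ 9 (<⇒≤ k≤t)))
        P = proj₁ new
        path′ : Fin (suc k) → Path x y
        path′ zero    = P
        path′ (suc i) = path i
        fresh : ∀ i → Compatible P (path i)
        fresh i = avoids⇒compatible P (path i)
          (proj₁ (proj₂ new) ∘ footprint⊆ i , proj₂ (proj₂ new) ∘ footprint⊆ i)
        compatible′ : ∀ {i j} → i ≢ j → Compatible (path′ i) (path′ j)
        compatible′ {zero}  {zero}  i≢j = contradiction refl i≢j
        compatible′ {zero}  {suc j} i≢j = fresh j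
        compatible′ {suc i} {zero}  i≢j = Compatible-sym (fresh i)
        compatible′ {suc i} {suc j} i≢j = compatible (i≢j ∘ cong suc)

    module _ {A : Set} {t : ℕ} where

      tabulate-Unique : (f : Fin t → A) → (∀ {i j} → i ≢ j → f i ≢ f j) → Unique (tabulate f)
      tabulate-Unique f ne = Unique.tabulate⁺ (λ {i} {j} eq → inj i j eq)
        where
        inj : ∀ i j → f i ≡ f j → i ≡ j
        inj i j eq with i Fin.≟ j
        ... | yes i≡j = i≡j
        ... | no  i≢j = contradiction eq (ne i≢j)

      tabulate-≢ : (f g : Fin t → A) → (∀ i → f i ≢ g i) → (∀ {i j} → i ≢ j → f i ≢ g j) →
                   ∀ {a} → a ∈ tabulate f → a ∉ tabulate g
      tabulate-≢ f g same diff a∈f a∈g with ∈-tabulate⁻ a∈f | ∈-tabulate⁻ a∈g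
      ... | i , refl | j , eq with i Fin.≟ j
      ...   | yes refl = same i eq
      ...   | no  i≢j  = diff i≢j eq

    family⇒theta : ∀ {t x y} → x ≢ y → PathFamily t x y → ThetaCopy t H
    family⇒theta {t} {x} {y} x≢y fam = record
      { x = x ; y = y
      ; v1 = P.v1 ∘ path ; v2 = P.v2 ∘ path
      ; e1 = P.e1 ∘ path ; e2 = P.e2 ∘ path ; e3 = P.e3 ∘ path
      ; vertsDistinct =
          (x≢y ∷ All.++⁺ (All.tabulate⁺ (P.x≢v1 ∘ path)) (All.tabulate⁺ (P.x≢v2 ∘ path))) ∷
          All.++⁺ (All.tabulate⁺ (P.y≢v1 ∘ path)) (All.tabulate⁺ (P.y≢v2 ∘ path)) ∷
          Unique.++⁺ (tabulate-Unique _ (C.v11 ∘ compatible)) (tabulate-Unique _ (C.v22 ∘ compatible))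
            (λ (a∈ , b∈) → tabulate-≢ _ _ (P.v1≢v2 ∘ path) (C.v12 ∘ compatible) a∈ b∈)
      ; edgesDistinct =
          Unique.++⁺ (tabulate-Unique _ (C.e11 ∘ compatible))
            (Unique.++⁺ (tabulate-Unique _ (C.e22 ∘ compatible)) (tabulate-Unique _ (C.e33 ∘ compatible))
              (λ (a∈ , b∈) → tabulate-≢ _ _ (P.e2≢e3 ∘ path) (C.e23 ∘ compatible) a∈ b∈))
            (λ (a∈ , b∈) → [ tabulate-≢ _ _ (P.e1≢e2 ∘ path) (C.e12 ∘ compatible) a∈
                           , tabulate-≢ _ _ (P.e1≢e3 ∘ path) (C.e13 ∘ compatible) a∈ ]′
                           (∈-++⁻ (tabulate (P.e2 ∘ path)) b∈))
      ; e1∈H = P.e1∈ ∘ path ; e2∈H = P.e2∈ ∘ path ; e3∈H = P.e3∈ ∘ path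
      ; x∈e1 = P.x∈e1 ∘ path ; v1∈e1 = P.v1∈e1 ∘ path ; v1∈e2 = P.v1∈e2 ∘ path
      ; v2∈e2 = P.v2∈e2 ∘ path ; v2∈e3 = P.v2∈e3 ∘ path ; y∈e3 = P.y∈e3 ∘ path }
      where
      open PathFamily fam
      module P {x} {y} = Path {x} {y}
      module C {x} {y} {P} {Q} = Compatible {x} {y} {P} {Q}

    avoiding⇒theta : ∀ {x y} t → x ≢ y → PathsAvoiding (t * 9) x y → ThetaCopy t H
    avoiding⇒theta t x≢y avoiding = family⇒theta x≢y (greedy t avoiding t ≤-refl)

    NoEdge : V → V → V → Set
    NoEdge u v w = ∀ {e} → e ∈ E → u Subset.∈ e → v Subset.∈ e → ¬ w Subset.∈ e

    ∉-span⇒NoEdge : ∀ {u v w} → u ≢ v → w ∉ span u v → NoEdge u v w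
    ∉-span⇒NoEdge u≢v w∉ e∈ u∈ v∈ w∈ = w∉ (∈-span e∈ u≢v u∈ v∈ w∈)

    -- The first `NoEdge` separates `e1` from both other edges, since either coincidence would put
    -- `x`, `v1`, `v2` on one edge; the second separates `e2` from `e3`.
    makePath : ∀ {x v1 v2 y} → Adj x v1 → Adj v1 v2 → Adj v2 y → x ≢ v2 → y ≢ v1 →
               NoEdge x v1 v2 → NoEdge v1 v2 y → ∃[ P ] (Path.v1 {x} {y} P ≡ v1 × Path.v2 P ≡ v2)
    makePath {v1 = v1} {v2} (x≢v1 , p1) (v1≢v2 , p2) (v2≢y , p3) x≢v2 y≢v1 none1 none2
      with find p1 | find p2 | find p3
    ... | e1 , e1∈ , x∈e1 , v1∈e1 | e2 , e2∈ , v1∈e2 , v2∈e2 | e3 , e3∈ , v2∈e3 , y∈e3 = record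
      { v1 = v1 ; v2 = v2 ; e1 = e1 ; e2 = e2 ; e3 = e3 ; e1∈ = e1∈ ; e2∈ = e2∈ ; e3∈ = e3∈
      ; x∈e1 = x∈e1 ; v1∈e1 = v1∈e1 ; v1∈e2 = v1∈e2 ; v2∈e2 = v2∈e2 ; v2∈e3 = v2∈e3 ; y∈e3 = y∈e3
      ; x≢v1 = x≢v1 ; x≢v2 = x≢v2 ; y≢v1 = y≢v1 ; y≢v2 = v2≢y ∘ sym ; v1≢v2 = v1≢v2
      ; e1≢e2 = λ { refl → none1 e1∈ x∈e1 v1∈e1 v2∈e2 }
      ; e1≢e3 = λ { refl → none1 e1∈ x∈e1 v1∈e1 v2∈e3 }
      ; e2≢e3 = λ { refl → none2 e2∈ v1∈e2 v2∈e2 y∈e3 } } , refl , refl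

    ∈-span-left : ∀ {u v} → Adj u v → u ∈ span u v
    ∈-span-left (u≢v , p) with find p
    ... | e , e∈ , ue , ve = ∈-span e∈ u≢v ue ve ue

    ∈-span-right : ∀ {u v} → Adj u v → v ∈ span u v
    ∈-span-right (u≢v , p) with find p
    ... | e , e∈ , ue , ve = ∈-span e∈ u≢v ue ve ve

    length-allFin : length (allFin n) ≡ n
    length-allFin = length-tabulate (λ (i : Fin n) → i)

    -- One pair of vertices is chosen in each edge, and by linearity the pair determines the edge.
    numEdges≤edgeCount : numEdges H ≤ edgeCount (allFin n) (allFin n)
    numEdges≤edgeCount = subst (numEdges H ≤_) (length-pairs (allFin n) (allFin n))
      (matching⇒length≤ InEdge
        (λ { (e∈ , u≢v , ue , ve) (f∈ , _ , uf , vf) → linear-≡ e∈ f∈ u≢v ue ve uf vf })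
        (distinct H) match)
      where
      InEdge : Subset n → V × V → Set
      InEdge e (u , v) = e ∈ E × u ≢ v × Joins u v e
      match : ∀ {e} → e ∈ E → ∃[ uv ] (uv ∈ pairs (allFin n) (allFin n) × InEdge e uv)
      match e∈ with ∣p∣>1⇒∃≢ (subst (2 ≤_) (sym (All.lookup (uniform H) e∈)) (s≤s (s≤s z≤n)))
      ... | u , v , ue , ve , u≢v = (u , v) ,
        ∈-pairs (∈-allFin u) (∈-allFin v) (u≢v , lose e∈ (ue , ve)) , e∈ , u≢v , ue , ve

    module Free (t : ℕ) (free : ¬ ThetaCopy t H) where

      -- `C` bounds the vertices excluded from a greedy choice in a core: `t * 9` forbidden ones and
      -- two edges of three vertices. `T` counts each forbidden vertex twice because its parent has
      -- to be avoided as well.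
      C T : ℕ
      C = t * 9 + 6
      T = t * 9 + t * 9

      -- Every y on the left of such a core starts enough paths y - b - v with v adjacent to x.
      core⇒theta : ∀ {x L Z} → (∀ {a} → a ∈ L → Adj x a) → Core C L Z → ThetaCopy t H
      core⇒theta {x} {L} {Z} x~ c = avoiding⇒theta t (proj₁ x~y) avoiding
        where
        open Core c
        y = root
        x~y : Adj x y
        x~y = x~ (left⊆ root∈)
        avoiding : PathsAvoiding (t * 9) x y
        avoiding F F≤ = let b , b∈ , y~b , b∉ = pick-b in via b∈ y~b b∉
          where
          pick-b : ∃[ b ] (b ∈ right × Adj y b × b ∉ x ∷ F)
          pick-b = count-avoid Fin._≟_ (adj? y) (x ∷ F) rightUnique
            (≤-<-trans (≤-trans (≤-reflexive (+-comm 1 (length F))) (+-mono-≤ F≤ (s≤s z≤n))) (leftDeg root∈))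
          -- The path is x - v - b - y. Avoiding the two spans keeps its consecutive edges distinct;
          -- as `span b y` contains `y`, it also gives `y ≢ v`.
          pick-v : ∀ {b} → b ∈ right → ∃[ v ] (v ∈ left × Adj v b × v ∉ F ++ span x b ++ span b y)
          pick-v {b} b∈ = count-avoid Fin._≟_ (λ v → adj? v b) (F ++ span x b ++ span b y) leftUnique
            (≤-<-trans (≤-trans
              (≤-reflexive (trans (length-++ F) (cong (length F +_) (length-++ (span x b)))))
              (+-mono-≤ F≤ (+-mono-≤ (length-span x b) (length-span b y)))) (rightDeg b∈))
          join : ∀ {b v} → Adj y b → b ∉ x ∷ F → v ∈ left → Adj v b → v ∉ F ++ span x b ++ span b y →
                 ∃[ P ] Avoids {x} {y} P F
          join {b} {v} y~b b∉ v∈ v~b v∉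
            with makePath (x~ (left⊆ v∈)) v~b (Adj-sym y~b) x≢b y≢v
                   (λ e∈ x∈ v∈ b∈ → v∉ (∈-++⁺ʳ F (∈-++⁺ˡ (∈-span e∈ x≢b x∈ b∈ v∈))))
                   (λ e∈ v∈ b∈ y∈ → v∉ (∈-++⁺ʳ F (∈-++⁺ʳ (span x b) (∈-span e∈ (proj₁ y~b ∘ sym) b∈ y∈ v∈))))
            where
            x≢b : x ≢ b
            x≢b refl = b∉ (here refl)
            y≢v : y ≢ v
            y≢v refl = v∉ (∈-++⁺ʳ F (∈-++⁺ʳ (span x b) (∈-span-right (Adj-sym y~b))))
          ... | P , refl , refl = P , v∉ ∘ ∈-++⁺ˡ , b∉ ∘ there
          via : ∀ {b} → b ∈ right → Adj y b → b ∉ x ∷ F → ∃[ P ] Avoids {x} {y} P F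
          via b∈ y~b b∉ = let v , v∈ , v~b , v∉ = pick-v b∈ in join y~b b∉ v∈ v~b v∉

      dense : ∀ {x L Z} → Unique L → Unique Z → (∀ {a} → a ∈ L → Adj x a) →
              edgeCount L Z ≤ C * (length L + length Z)
      dense uL uZ x~ = ≮⇒≥ (λ lt → free (core⇒theta x~ (core C uL uZ lt)))

      -- Rooted at a vertex of a core of the whole graph, the levels of the breadth-first tree
      -- grow by factors of order D.
      module Levels (D : ℕ) (c : Core (D + C + 4) (allFin n) (allFin n)) where

        open ≤-Reasoning
        open Core c

        -- A vertex loses at most four neighbours on passing to the next level, the three points of
        -- an edge and the root. Of the remaining degree `D + C`, the part `C` pays for the term
        -- `C * length L` in `dense`.
        δ = D + C + 4

        x = root

        -- dense turns a lower bound D + C on the degrees into expansion by D / C.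
        expand : ∀ {x L Z} → Unique L → Unique Z → (∀ {a} → a ∈ L → Adj x a) →
                 (∀ {a} → a ∈ L → δ ≤ count (adj? a) Z + 4) → D * length L ≤ C * length Z
        expand {x} {L} {Z} uL uZ x~ deg = +-cancelʳ-≤ (C * length L) _ _ (begin
          D * length L + C * length L   ≡⟨ *-distribʳ-+ (length L) D C ⟨
          (D + C) * length L            ≡⟨ *-comm (D + C) (length L) ⟩
          length L * (D + C)            ≡⟨ sumOver-const L (D + C) ⟨
          sumOver L (λ _ → D + C)       ≤⟨ sumOver-mono L (λ a∈ → +-cancelʳ-≤ 4 _ _ (deg a∈)) ⟩
          edgeCount L Z                 ≤⟨ dense uL uZ x~ ⟩
          C * (length L + length Z)     ≡⟨ *-distribˡ-+ C (length L) (length Z) ⟩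
          C * length L + C * length Z   ≡⟨ +-comm (C * length L) _ ⟩
          C * length Z + C * length L   ∎)

        -- The levels alternate between the sides of the core: root on the left, `L1` on the right,
        -- `L2` on the left, the branches on the right.
        L1 : List V
        L1 = filter (adj? x) right

        uL1 : Unique L1
        uL1 = Unique.filter⁺ (adj? x) rightUnique

        L1⇒Adj : ∀ {a} → a ∈ L1 → Adj x a
        L1⇒Adj a∈ = proj₂ (∈-filter⁻ (adj? x) {xs = right} a∈)

        D≤L1 : D ≤ length L1
        D≤L1 = begin
          D                      ≤⟨ ≤-trans (m≤m+n D C) (m≤m+n (D + C) 4) ⟩
          δ                      ≤⟨ <⇒≤ (leftDeg root∈) ⟩
          count (adj? x) right   ≡⟨ length-filter≡count (adj? x) right ⟨
          length L1              ∎

        -- With `b` off the edge through `x` and `a`, the steps from `x` to `a` and from `a` to `b`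
        -- use different edges. Since `x` lies in that span, `b ≢ x` follows too.
        Parent : V → V → Set
        Parent b a = Adj a b × b ∉ span x a

        parent? : ∀ b a → Dec (Parent b a)
        parent? b a = adj? a b ×-dec (b ∉? span x a)

        hasParent? : ∀ b → Dec (Any (Parent b) L1)
        hasParent? b = any? (parent? b) L1

        L2 : List V
        L2 = filter hasParent? left

        uL2 : Unique L2
        uL2 = Unique.filter⁺ hasParent? leftUnique

        D*L1≤ : D * length L1 ≤ C * length L2
        D*L1≤ = expand uL1 uL2 L1⇒Adj (λ {a} a∈ → ≤-trans
          (<⇒≤ (rightDeg (proj₁ (∈-filter⁻ (adj? x) {xs = right} a∈))))
          (≤-trans
            (count-≤-filter Fin._≟_ (λ b → adj? b a) (adj? a) hasParent? (span x a) leftUnique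
              (λ _ b~a b∉ → Adj-sym b~a , lose a∈ (Adj-sym b~a , b∉)))
            (+-monoʳ-≤ _ (≤-trans (length-span x a) (n≤1+n 3)))))

        parent : V → V
        parent b with hasParent? b
        ... | yes p = proj₁ (find p)
        -- A default value for vertices without a parent, which makes `map parent F` meaningful for
        -- arbitrary `F`; only the values on `L2` are specified.
        ... | no  _ = x

        parent-spec : ∀ {b} → b ∈ L2 → parent b ∈ L1 × Parent b (parent b)
        parent-spec {b} b∈ with hasParent? b | ∈-filter⁻ hasParent? {xs = left} b∈
        ... | yes p | _     = proj₂ (find p)
        ... | no ¬p | _ , p = contradiction p ¬p

        children : V → List V
        children a = filter (λ b → parent b Fin.≟ a) L2

        children⁻ : ∀ {a b} → b ∈ children a → b ∈ L2 × parent b ≡ a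
        children⁻ {a} = ∈-filter⁻ (λ b → parent b Fin.≟ a) {xs = L2}

        L2≤children : length L2 ≤ sumOver L1 (length ∘ children)
        L2≤children = begin
          length L2                                              ≡⟨ *-identityʳ (length L2) ⟨
          length L2 * 1                                          ≡⟨ sumOver-const L2 1 ⟨
          sumOver L2 (λ _ → 1)                                   ≤⟨ sumOver-mono L2 (λ {b} b∈ → member⇒count>0 (parent b Fin.≟_) (proj₁ (parent-spec b∈)) refl) ⟩
          sumOver L2 (λ b → count (λ a → parent b Fin.≟ a) L1)   ≡⟨ sumOver-swap L2 L1 _ ⟩
          sumOver L1 (λ a → count (λ b → parent b Fin.≟ a) L2)   ≤⟨ sumOver-mono L1 (λ {a} _ →
                                                                      ≤-reflexive (sym (length-filter≡count (λ b → parent b Fin.≟ a) L2))) ⟩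
          sumOver L1 (length ∘ children)                         ∎

        -- The excluded vertices make x - a - b - z a path: `x` itself is not a possible other end,
        -- and `span a b` both contains `a` and is the edge that the last step must not reuse.
        Below : V → V → V → Set
        Below a z b = Adj b z × z ∉ x ∷ span a b

        below? : ∀ a z → Dec (Any (Below a z) (children a))
        below? a z = any? (λ b → adj? b z ×-dec (z ∉? (x ∷ span a b))) (children a)

        branch : V → List V
        branch a = filter (below? a) right

        -- Here `expand` is centred at `a` instead of the root, since the children of `a` are
        -- neighbours of `a`.
        D*children≤ : ∀ {a} → D * length (children a) ≤ C * length (branch a)
        D*children≤ {a} = expand (Unique.filter⁺ _ uL2) (Unique.filter⁺ (below? a) rightUnique) a~ (λ {b} b∈ →
          ≤-trans
            (<⇒≤ (leftDeg (proj₁ (∈-filter⁻ hasParent? {xs = left} (proj₁ (children⁻ b∈))))))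
            (≤-trans
              (count-≤-filter Fin._≟_ (adj? b) (adj? b) (below? a) (x ∷ span a b) rightUnique
                (λ _ b~z z∉ → b~z , lose b∈ (b~z , z∉)))
              (+-monoʳ-≤ _ (s≤s (length-span a b)))))
          where
          a~ : ∀ {b} → b ∈ children a → Adj a b
          a~ b∈ with children⁻ b∈
          ... | b∈L2 , refl = proj₁ (proj₂ (parent-spec b∈L2))

        -- Branches through different vertices of L1 give paths that are already nearly disjoint.
        branches⇒theta : ∀ z → T < count (λ a → below? a z) L1 → ThetaCopy t H
        branches⇒theta z many = avoiding⇒theta t x≢z avoiding
          where
          x≢z : x ≢ z
          x≢z refl =
            let _ , _ , p = count>0⇒∃ (λ a → below? a z) L1 (≤-<-trans z≤n many)
                _ , _ , _ , z∉ = find p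
            in z∉ (here refl)
          module _ (F : List V) where
            -- Avoiding the parents of `F` as well means that no vertex `b` with parent `a` can lie
            -- in `F`, whichever child is taken afterwards.
            pick : length F ≤ t * 9 → ∃[ a ] (a ∈ L1 × Any (Below a z) (children a) × a ∉ F ++ map parent F)
            pick F≤ = count-avoid Fin._≟_ (λ a → below? a z) (F ++ map parent F) uL1
              (≤-<-trans (≤-trans (≤-reflexive (trans (length-++ F) (cong (length F +_) (length-map parent F))))
                (+-mono-≤ F≤ F≤)) many)
            join : ∀ {b} → b ∈ L2 → Below (parent b) z b → parent b ∉ F ++ map parent F → ∃[ P ] Avoids {x} {z} P F
            join {b} b∈ (b~z , z∉) a∉
              with makePath x~a a~b b~z x≢b z≢a (∉-span⇒NoEdge (proj₁ x~a) b∉) (∉-span⇒NoEdge (proj₁ a~b) (z∉ ∘ there))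
              where
              x~a : Adj x (parent b)
              x~a = L1⇒Adj (proj₁ (parent-spec b∈))
              a~b : Adj (parent b) b
              a~b = proj₁ (proj₂ (parent-spec b∈))
              b∉ : b ∉ span x (parent b)
              b∉ = proj₂ (proj₂ (parent-spec b∈))
              x≢b : x ≢ b
              x≢b x≡b = b∉ (subst (_∈ span x (parent b)) x≡b (∈-span-left x~a))
              z≢a : z ≢ parent b
              z≢a z≡a = z∉ (there (subst (_∈ span (parent b) b) (sym z≡a) (∈-span-left a~b)))
            ... | P , v1≡ , v2≡ = P , subst (_∉ F) (sym v1≡) (a∉ ∘ ∈-++⁺ˡ) ,
                                      subst (_∉ F) (sym v2≡) (a∉ ∘ ∈-++⁺ʳ F ∘ ∈-map⁺ parent)
            via : ∀ {a} → Any (Below a z) (children a) → a ∉ F ++ map parent F → ∃[ P ] Avoids {x} {z} P F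
            via p a∉ with find p
            ... | b , b∈ , below with children⁻ b∈
            ...   | b∈L2 , refl = join b∈L2 below a∉
          avoiding : PathsAvoiding (t * 9) x z
          avoiding F F≤ = let a , _ , p , a∉ = pick F F≤ in via F p a∉

        branches≤ : ∀ z → count (λ a → below? a z) L1 ≤ T
        branches≤ z = ≮⇒≥ (free ∘ branches⇒theta z)

        -- Double counting of the pairs of a branch and a vertex in it: each vertex lies in at most
        -- `T` branches.
        branches-total : sumOver L1 (length ∘ branch) ≤ n * T
        branches-total = begin
          sumOver L1 (length ∘ branch)                        ≤⟨ sumOver-mono L1 (λ {a} _ → ≤-reflexive (length-filter≡count (below? a) right)) ⟩
          sumOver L1 (λ a → count (below? a) right)           ≡⟨ sumOver-swap L1 right _ ⟩
          sumOver right (λ z → count (λ a → below? a z) L1)   ≤⟨ sumOver-mono right (λ {z} _ → branches≤ z) ⟩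
          sumOver right (λ _ → T)                             ≡⟨ sumOver-const right T ⟩
          length right * T                                    ≤⟨ *-monoˡ-≤ T (Unique⊆⇒length≤ rightUnique right⊆) ⟩
          length (allFin n) * T                               ≡⟨ cong (_* T) length-allFin ⟩
          n * T                                               ∎

        D*L2≤ : D * length L2 ≤ C * (n * T)
        D*L2≤ = begin
          D * length L2                                ≤⟨ *-monoʳ-≤ D L2≤children ⟩
          D * sumOver L1 (length ∘ children)           ≡⟨ sumOver-* L1 D _ ⟨
          sumOver L1 (λ a → D * length (children a))   ≤⟨ sumOver-mono L1 (λ {a} _ → D*children≤ {a}) ⟩
          sumOver L1 (λ a → C * length (branch a))     ≡⟨ sumOver-* L1 C _ ⟩
          C * sumOver L1 (length ∘ branch)             ≤⟨ *-monoʳ-≤ C branches-total ⟩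
          C * (n * T)                                  ∎

        cube≤ : D * (D * D) ≤ C * (C * (n * T))
        cube≤ = begin
          D * (D * D)           ≤⟨ *-monoʳ-≤ D (≤-trans (*-monoʳ-≤ D D≤L1) D*L1≤) ⟩
          D * (C * length L2)   ≡⟨ swap D C (length L2) ⟩
          C * (D * length L2)   ≤⟨ *-monoʳ-≤ C D*L2≤ ⟩
          C * (C * (n * T))     ∎
          where
          swap : ∀ a b c → a * (b * c) ≡ b * (a * c)
          swap = solve-∀

      -- The adjacency graph is replaced by its bipartite double cover, with all vertices on both
      -- sides; hence the size `n + n`.
      numEdges>⇒cube≤ : ∀ D → (D + C + 4) * (n + n) < numEdges H → D * (D * D) ≤ C * (C * (n * T))
      numEdges>⇒cube≤ D many = Levels.cube≤ D (core δ (Unique.allFin⁺ n) (Unique.allFin⁺ n)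
        (subst (λ s → δ * s < edgeCount (allFin n) (allFin n)) (sym size)
          (<-≤-trans many numEdges≤edgeCount)))
        where
        δ = D + C + 4
        size : length (allFin n) + length (allFin n) ≡ n + n
        size = cong₂ _+_ length-allFin length-allFin

-- From the cubic inequality for the degree to the bound on the number of edges.

module UpperBound where

  open ThetaPaths
  open import Data.Nat
  open import Data.Nat.Properties
  open import Data.Nat.DivMod using (_/_; _%_; m≡m%n+[m/n]*n; m%n<n)
  open import Data.Nat.Tactic.RingSolver using (solve-∀)
  open import Relation.Nullary using (yes; no)
  open import Relation.Binary.PropositionalEquality

  -- The 64 is 8 * 8: one factor comes from comparing `suc D ^ 3` with `D ^ 3 + 1`, the other from
  -- the cube of `n + n`. The summand 1 absorbs that `+ 1` through `1 ≤ n`.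
  upperConst : ℕ → ℕ
  upperConst t = 64 * ((C * (C * T) + 1) * (C + 6) ^ 3)
    where
    C = t * 9 + 6
    T = t * 9 + t * 9

  [1+n]³≤8[n³+1] : ∀ n → suc n ^ 3 ≤ 8 * (n * (n * n) + 1)
  [1+n]³≤8[n³+1] zero    = s≤s z≤n
  [1+n]³≤8[n³+1] (suc n) = begin
    (2 + n) ^ 3                      ≤⟨ ^-monoˡ-≤ 3 (m≤m+n (2 + n) n) ⟩
    (2 + n + n) ^ 3                  ≡⟨ cube n ⟩
    8 * (suc n * (suc n * suc n))    ≤⟨ *-monoʳ-≤ 8 (m≤m+n (suc n * (suc n * suc n)) 1) ⟩
    8 * (suc n * (suc n * suc n) + 1) ∎
    where
    open ≤-Reasoning
    cube : ∀ n → (2 + n + n) * ((2 + n + n) * ((2 + n + n) * 1)) ≡ 8 * (suc n * (suc n * suc n))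
    cube = solve-∀

  upperBound : ∀ t n → .{{NonZero n}} → ExLinUpper t (upperConst t) n
  upperBound t n H linear free = begin
    m ^ 3
      ≤⟨ ^-monoˡ-≤ 3 m≤ ⟩
    (suc D * (C + 6) * (n + n)) ^ 3
      ≡⟨ regroup (suc D) (C + 6) n ⟩
    suc D ^ 3 * ((C + 6) ^ 3 * (8 * n ^ 3))
      ≤⟨ *-monoˡ-≤ ((C + 6) ^ 3 * (8 * n ^ 3)) (≤-trans ([1+n]³≤8[n³+1] D) (*-monoʳ-≤ 8 (+-mono-≤ D³≤ (>-nonZero⁻¹ n)))) ⟩
    8 * (C * (C * (n * T)) + n) * ((C + 6) ^ 3 * (8 * n ^ 3))
      ≡⟨ collect C T n ((C + 6) ^ 3) ⟩
    upperConst t * n ^ 4 ∎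
    where
    open ≤-Reasoning
    open Upper H linear using (module Free)
    open Free t free using (numEdges>⇒cube≤; C; T)
    instance
      n+n≢0 : NonZero (n + n)
      n+n≢0 = >-nonZero (≤-trans (>-nonZero⁻¹ n) (m≤m+n n n))
    m = numEdges H
    q = m / (n + n)
    -- One more than the `C + 4` of the core threshold, because the edge count must exceed that
    -- threshold strictly. If `q` is too small, truncation gives 0 and the cubic bound is trivial.
    D = q ∸ (C + 5)

    m<[1+q]*2n : m < suc q * (n + n)
    m<[1+q]*2n = subst (_< suc q * (n + n)) (sym (m≡m%n+[m/n]*n m (n + n)))
      (+-monoˡ-< (q * (n + n)) (m%n<n m (n + n)))

    D³≤ : D * (D * D) ≤ C * (C * (n * T))
    D³≤ with C + 5 ≤? q
    ... | no ≰ = subst (λ d → d * (d * d) ≤ C * (C * (n * T))) (sym (m≤n⇒m∸n≡0 (<⇒≤ (≰⇒> ≰)))) z≤n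
    ... | yes ≤q = numEdges>⇒cube≤ D (begin-strict
      (D + C + 4) * (n + n)        <⟨ *-monoˡ-< (n + n) (n<1+n (D + C + 4)) ⟩
      suc (D + C + 4) * (n + n)    ≡⟨ cong (_* (n + n)) (trans (shift D C) (m∸n+n≡m ≤q)) ⟩
      q * (n + n)                  ≤⟨ m≤n+m (q * (n + n)) (m % (n + n)) ⟩
      m % (n + n) + q * (n + n)    ≡⟨ m≡m%n+[m/n]*n m (n + n) ⟨
      m                            ∎)
      where
      shift : ∀ D C → suc (D + C + 4) ≡ D + (C + 5)
      shift = solve-∀

    -- The sum `suc q` is majorised by a product so that its cube splits into a power of `suc D` and
    -- a constant.
    m≤ : m ≤ suc D * (C + 6) * (n + n)
    m≤ = ≤-trans (<⇒≤ m<[1+q]*2n) (*-monoˡ-≤ (n + n) (begin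
      suc q                      ≤⟨ s≤s (m≤n+m∸n q (C + 5)) ⟩
      suc (C + 5 + D)            ≤⟨ m≤m+n _ (D * (C + 5)) ⟩
      suc (C + 5 + D) + D * (C + 5) ≡⟨ factor C D ⟩
      suc D * (C + 6)            ∎))
      where
      factor : ∀ C D → suc (C + 5 + D) + D * (C + 5) ≡ suc D * (C + 6)
      factor = solve-∀

    regroup : ∀ d c n → (d * c * (n + n)) * ((d * c * (n + n)) * ((d * c * (n + n)) * 1)) ≡
                        d * (d * (d * 1)) * (c * (c * (c * 1)) * (8 * (n * (n * (n * 1)))))
    regroup = solve-∀
    collect : ∀ C T n e → 8 * (C * (C * (n * T)) + n) * (e * (8 * (n * (n * (n * 1))))) ≡
                          64 * ((C * (C * T) + 1) * e) * (n * (n * (n * (n * 1))))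
    collect = solve-∀

-- Elimination in the weighted power sum equations.

module MomentEquations where

  open import Data.Nat as ℕ using (ℕ; suc; s≤s)
  import Data.Nat.Properties as ℕ
  import Data.Nat.Divisibility as ℕ
  open import Data.Nat.Primality using (Prime; euclidsLemma)
  open import Data.Integer using (ℤ; +_; _+_; _*_; _-_; -_; 0ℤ; ∣_∣)
  open import Data.Integer.Properties using (abs-*; +-inverseʳ)
  open import Data.Integer.Divisibility.Signed
  open import Data.Integer.Tactic.RingSolver using (solve-∀)
  open import Data.List using (List; []; _∷_; length; map)
  open import Data.List.Properties using (length-map)
  import Data.List.Relation.Unary.All.Properties as All
  import Data.List.Relation.Unary.AllPairs.Properties as AllPairs
  open import Data.List.Relation.Unary.All as All using (All; []; _∷_)
  open import Data.List.Relation.Unary.AllPairs using (AllPairs; []; _∷_)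
  open import Data.Product using (_×_; _,_; proj₁; proj₂)
  open import Data.Sum as Sum using (_⊎_; [_,_]′)
  open import Function using (_∘_)
  open import Relation.Nullary using (¬_; contradiction)
  open import Relation.Binary.PropositionalEquality

  eval : List ℤ → ℤ → ℤ
  eval []       x = 0ℤ
  eval (c ∷ cs) x = c + x * eval cs x

  -- The quotient of cs by the monic linear polynomial with root a.
  divide : List ℤ → ℤ → List ℤ
  divide []           a = []
  divide (c ∷ [])     a = []
  divide (c ∷ d ∷ cs) a = eval (d ∷ cs) a ∷ divide (d ∷ cs) a

  length-divide : ∀ c cs a → length (divide (c ∷ cs) a) ≡ length cs
  length-divide c []       a = refl
  length-divide c (d ∷ cs) a = cong suc (length-divide d cs a)

  -- Synthetic division over the integers for an arbitrary `a`; when both values on the left vanish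
  -- modulo a prime and `x` differs from `a`, the quotient vanishes at `x`.
  eval-divide : ∀ cs a x → eval cs x - eval cs a ≡ (x - a) * eval (divide cs a) x
  eval-divide [] a x = zeros (x - a)
    where
    zeros : ∀ y → 0ℤ - 0ℤ ≡ y * 0ℤ
    zeros = solve-∀
  eval-divide (c ∷ []) a x = constant c a x
    where
    constant : ∀ c a x → c + x * 0ℤ - (c + a * 0ℤ) ≡ (x - a) * 0ℤ
    constant = solve-∀
  eval-divide (c ∷ d ∷ cs) a x = begin
    c + x * eval (d ∷ cs) x - (c + a * eval (d ∷ cs) a)
      ≡⟨ split c x a (eval (d ∷ cs) x) (eval (d ∷ cs) a) ⟩
    x * (eval (d ∷ cs) x - eval (d ∷ cs) a) + (x - a) * eval (d ∷ cs) a
      ≡⟨ cong (λ y → x * y + (x - a) * eval (d ∷ cs) a) (eval-divide (d ∷ cs) a x) ⟩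
    x * ((x - a) * eval (divide (d ∷ cs) a) x) + (x - a) * eval (d ∷ cs) a
      ≡⟨ merge x a (eval (divide (d ∷ cs) a) x) (eval (d ∷ cs) a) ⟩
    (x - a) * (eval (d ∷ cs) a + x * eval (divide (d ∷ cs) a) x) ∎
    where
    open ≡-Reasoning
    split : ∀ c x a e f → c + x * e - (c + a * f) ≡ x * (e - f) + (x - a) * f
    split = solve-∀
    merge : ∀ x a q f → x * ((x - a) * q) + (x - a) * f ≡ (x - a) * (f + x * q)
    merge = solve-∀

  eval₅ : ∀ c₀ c₁ c₂ c₃ c₄ t → eval (c₀ ∷ c₁ ∷ c₂ ∷ c₃ ∷ c₄ ∷ []) t ≡
          c₀ + t * (c₁ + t * (c₂ + t * (c₃ + t * (c₄ + t * 0ℤ))))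
  eval₅ c₀ c₁ c₂ c₃ c₄ t = refl

  -- Weights (α, β, - β): the unknowns u and v are eliminated from the power sums
  -- c₁ = α s + β (u - v), ..., c₃ = α s³ + β (u³ - v³) through the identity
  -- 4 (u - v) (u³ - v³) = 3 (u² - v²)² + (u - v)⁴.
  -- The formulas are opaque because integer multiplication unfolds during conversion checking.
  opaque
    antipodal : (α β t c1 c2 c3 : ℤ) → ℤ
    antipodal α β t c1 c2 c3 =
      + 4 * (α * (β * β) * (t * t * t)) * (c1 - α * t)
      + + 3 * (β * β) * ((c2 - α * (t * t)) * (c2 - α * (t * t)))
      + (c1 - α * t) * (c1 - α * t) * (c1 - α * t) * (c1 - α * t)
      - + 4 * (β * β) * (c3 * (c1 - α * t))

    a₀ a₁ a₂ a₃ : (α β c1 c2 c3 : ℤ) → ℤ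
    a₀ α β c1 c2 c3 = + 3 * (β * β) * (c2 * c2) + c1 * c1 * c1 * c1 - + 4 * (β * β) * (c3 * c1)
    a₁ α β c1 c2 c3 = + 4 * α * (β * β) * c3 - + 4 * α * (c1 * c1 * c1)
    a₂ α β c1 c2 c3 = + 6 * (α * α) * (c1 * c1) - + 6 * α * (β * β) * c2
    a₃ α β c1 c2 c3 = + 4 * α * (β * β) * c1 - + 4 * (α * α * α) * c1

    -- For nonzero `α` this vanishes only when the squares of the weights agree, which is the
    -- alternating pattern.
    a₄ : (α β : ℤ) → ℤ
    a₄ α β = α * α * (α * α - β * β)

    a₄-≡ : ∀ α β → a₄ α β ≡ α * α * (α * α - β * β)
    a₄-≡ α β = refl

    antipodal-expand : ∀ α β c1 c2 c3 t →
      a₀ α β c1 c2 c3 + t * (a₁ α β c1 c2 c3 + t * (a₂ α β c1 c2 c3 +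
        t * (a₃ α β c1 c2 c3 + t * (a₄ α β + t * 0ℤ)))) ≡ antipodal α β t c1 c2 c3
    antipodal-expand α β c1 c2 c3 t = raw α β c1 c2 c3 t
      where
      raw : ∀ α β c1 c2 c3 t →
        (+ 3 * (β * β) * (c2 * c2) + c1 * c1 * c1 * c1 - + 4 * (β * β) * (c3 * c1)) + t * (
        (+ 4 * α * (β * β) * c3 - + 4 * α * (c1 * c1 * c1)) + t * (
        (+ 6 * (α * α) * (c1 * c1) - + 6 * α * (β * β) * c2) + t * (
        (+ 4 * α * (β * β) * c1 - + 4 * (α * α * α) * c1) + t * (
        (α * α * (α * α - β * β)) + t * 0ℤ)))) ≡
        + 4 * (α * (β * β) * (t * t * t)) * (c1 - α * t)
        + + 3 * (β * β) * ((c2 - α * (t * t)) * (c2 - α * (t * t)))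
        + (c1 - α * t) * (c1 - α * t) * (c1 - α * t) * (c1 - α * t)
        - + 4 * (β * β) * (c3 * (c1 - α * t))
      raw = solve-∀

    antipodal-vanish : ∀ α β s u v →
      antipodal α β s (α * s + β * u + (- β) * v)
                      (α * (s * s) + β * (u * u) + (- β) * (v * v))
                      (α * (s * s * s) + β * (u * u * u) + (- β) * (v * v * v)) ≡ 0ℤ
    antipodal-vanish α β s u v = raw α β s u v
      where
      raw : ∀ α β s u v →
        let c1 = α * s + β * u + (- β) * v
            c2 = α * (s * s) + β * (u * u) + (- β) * (v * v)
            c3 = α * (s * s * s) + β * (u * u * u) + (- β) * (v * v * v)
        in
        + 4 * (α * (β * β) * (s * s * s)) * (c1 - α * s)
        + + 3 * (β * β) * ((c2 - α * (s * s)) * (c2 - α * (s * s)))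
        + (c1 - α * s) * (c1 - α * s) * (c1 - α * s) * (c1 - α * s)
        - + 4 * (β * β) * (c3 * (c1 - α * s)) ≡ 0ℤ
      raw = solve-∀

    -- For equal weights both `a₃` and `a₄` vanish, so this coefficient takes over. Its factors
    -- compare the parameter `v` of negative weight, which will belong to the middle edge, with the
    -- two others.
    a₂-alternating : ∀ α s u v →
      a₂ α α (α * s + α * u + (- α) * v) (α * (s * s) + α * (u * u) + (- α) * (v * v)) 0ℤ ≡
      + 6 * + 2 * (α * α * (α * α)) * ((s - v) * (u - v))
    a₂-alternating α s u v = raw α s u v
      where
      raw : ∀ α s u v →
        let c1 = α * s + α * u + (- α) * v
            c2 = α * (s * s) + α * (u * u) + (- α) * (v * v)
        in + 6 * (α * α) * (c1 * c1) - + 6 * α * (α * α) * c2 ≡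
           + 6 * + 2 * (α * α * (α * α)) * ((s - v) * (u - v))
      raw = solve-∀

  -- Weights (- m, β, γ) with m = β + γ: after moving s to the origin the power sums are those of
  -- weights β, γ at u - s, v - s. Their second and third central moments M₀ + M₁ s and
  -- N₀ + N₁ s + N₂ s² are multiples of (u - v)² and (u - v)³.
  opaque
    M₀ M₁ N₀ N₁ N₂ : (m c1 c2 c3 : ℤ) → ℤ
    M₀ m c1 c2 c3 = m * c2 - c1 * c1
    M₁ m c1 c2 c3 = 0ℤ - + 2 * m * c1
    N₀ m c1 c2 c3 = m * m * c3 - + 3 * m * (c1 * c2) + + 2 * (c1 * c1 * c1)
    N₁ m c1 c2 c3 = + 6 * m * (c1 * c1) - + 3 * (m * m) * c2
    N₂ m c1 c2 c3 = + 3 * (m * m) * c1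

    M-central : ∀ β γ s u v →
      let c1 = (- (β + γ)) * s + β * u + γ * v
          c2 = (- (β + γ)) * (s * s) + β * (u * u) + γ * (v * v)
          c3 = (- (β + γ)) * (s * s * s) + β * (u * u * u) + γ * (v * v * v)
      in M₀ (β + γ) c1 c2 c3 + M₁ (β + γ) c1 c2 c3 * s ≡ β * γ * ((u - v) * (u - v))
    M-central β γ s u v = raw β γ s u v
      where
      raw : ∀ β γ s u v →
        let m  = β + γ
            c1 = (- (β + γ)) * s + β * u + γ * v
            c2 = (- (β + γ)) * (s * s) + β * (u * u) + γ * (v * v)
        in (m * c2 - c1 * c1) + (0ℤ - + 2 * m * c1) * s ≡ β * γ * ((u - v) * (u - v))
      raw = solve-∀

    N-central : ∀ β γ s u v →
      let c1 = (- (β + γ)) * s + β * u + γ * v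
          c2 = (- (β + γ)) * (s * s) + β * (u * u) + γ * (v * v)
          c3 = (- (β + γ)) * (s * s * s) + β * (u * u * u) + γ * (v * v * v)
      in N₀ (β + γ) c1 c2 c3 + N₁ (β + γ) c1 c2 c3 * s + N₂ (β + γ) c1 c2 c3 * (s * s) ≡
         β * γ * (γ - β) * ((u - v) * (u - v) * (u - v))
    N-central β γ s u v = raw β γ s u v
      where
      raw : ∀ β γ s u v →
        let m  = β + γ
            c1 = (- (β + γ)) * s + β * u + γ * v
            c2 = (- (β + γ)) * (s * s) + β * (u * u) + γ * (v * v)
            c3 = (- (β + γ)) * (s * s * s) + β * (u * u * u) + γ * (v * v * v)
        in (m * m * c3 - + 3 * m * (c1 * c2) + + 2 * (c1 * c1 * c1))
           + (+ 6 * m * (c1 * c1) - + 3 * (m * m) * c2) * s + (+ 3 * (m * m) * c1) * (s * s)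
           ≡ β * γ * (γ - β) * ((u - v) * (u - v) * (u - v))
      raw = solve-∀

    M₀-00 : ∀ m c3 → M₀ m 0ℤ 0ℤ c3 ≡ 0ℤ
    M₀-00 m c3 = raw m
      where
      raw : ∀ m → m * 0ℤ - 0ℤ * 0ℤ ≡ 0ℤ
      raw = solve-∀

    M₁-0 : ∀ m c2 c3 → M₁ m 0ℤ c2 c3 ≡ 0ℤ
    M₁-0 m c2 c3 = raw m
      where
      raw : ∀ m → 0ℤ - + 2 * m * 0ℤ ≡ 0ℤ
      raw = solve-∀

    N₁-0 : ∀ m c2 c3 → N₁ m 0ℤ c2 c3 ≡ (- + 3) * (m * m) * c2
    N₁-0 m c2 c3 = raw m c2
      where
      raw : ∀ m c2 → + 6 * m * (0ℤ * 0ℤ) - + 3 * (m * m) * c2 ≡ (- + 3) * (m * m) * c2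
      raw = solve-∀

    N₂-≡ : ∀ m c1 c2 c3 → N₂ m c1 c2 c3 ≡ + 3 * (m * m) * c1
    N₂-≡ m c1 c2 c3 = refl

  opaque
    -- Coefficients in t of K N(t)² - κ M(t)³, where M(t) = M₀ + M₁ t and N(t) = N₀ + N₁ t + N₂ t².
    -- As M and N are multiples of the square and the cube of u - v, this combination removes the
    -- last unknown difference.
    b₀ b₁ b₂ b₃ b₄ : (K κ M₀ M₁ N₀ N₁ N₂ : ℤ) → ℤ
    b₀ K κ M₀ M₁ N₀ N₁ N₂ = K * (N₀ * N₀) - κ * (M₀ * M₀ * M₀)
    b₁ K κ M₀ M₁ N₀ N₁ N₂ = + 2 * K * (N₀ * N₁) - + 3 * κ * (M₀ * M₀ * M₁)
    b₂ K κ M₀ M₁ N₀ N₁ N₂ = K * (N₁ * N₁ + + 2 * (N₀ * N₂)) - + 3 * κ * (M₀ * (M₁ * M₁))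
    b₃ K κ M₀ M₁ N₀ N₁ N₂ = + 2 * K * (N₁ * N₂) - κ * (M₁ * M₁ * M₁)
    b₄ K κ M₀ M₁ N₀ N₁ N₂ = K * (N₂ * N₂)

    b₄-≡ : ∀ K κ M₀ M₁ N₀ N₁ N₂ → b₄ K κ M₀ M₁ N₀ N₁ N₂ ≡ K * (N₂ * N₂)
    b₄-≡ K κ M₀ M₁ N₀ N₁ N₂ = refl

    b₂-00 : ∀ K κ M₀ N₀ N₁ → b₂ K κ M₀ 0ℤ N₀ N₁ 0ℤ ≡ K * (N₁ * N₁)
    b₂-00 K κ M₀ N₀ N₁ = raw K κ M₀ N₀ N₁
      where
      raw : ∀ K κ M₀ N₀ N₁ → K * (N₁ * N₁ + + 2 * (N₀ * 0ℤ)) - + 3 * κ * (M₀ * (0ℤ * 0ℤ)) ≡ K * (N₁ * N₁)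
      raw = solve-∀

    balanced-expand : ∀ K κ M₀ M₁ N₀ N₁ N₂ t →
      b₀ K κ M₀ M₁ N₀ N₁ N₂ + t * (b₁ K κ M₀ M₁ N₀ N₁ N₂ + t * (b₂ K κ M₀ M₁ N₀ N₁ N₂ +
        t * (b₃ K κ M₀ M₁ N₀ N₁ N₂ + t * (b₄ K κ M₀ M₁ N₀ N₁ N₂ + t * 0ℤ)))) ≡
      K * ((N₀ + N₁ * t + N₂ * (t * t)) * (N₀ + N₁ * t + N₂ * (t * t)))
      - κ * ((M₀ + M₁ * t) * (M₀ + M₁ * t) * (M₀ + M₁ * t))
    balanced-expand K κ M₀ M₁ N₀ N₁ N₂ t = raw K κ M₀ M₁ N₀ N₁ N₂ t
      where
      raw : ∀ K κ M₀ M₁ N₀ N₁ N₂ t →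
        (K * (N₀ * N₀) - κ * (M₀ * M₀ * M₀)) + t * (
        (+ 2 * K * (N₀ * N₁) - + 3 * κ * (M₀ * M₀ * M₁)) + t * (
        (K * (N₁ * N₁ + + 2 * (N₀ * N₂)) - + 3 * κ * (M₀ * (M₁ * M₁))) + t * (
        (+ 2 * K * (N₁ * N₂) - κ * (M₁ * M₁ * M₁)) + t * (
        (K * (N₂ * N₂)) + t * 0ℤ)))) ≡
        K * ((N₀ + N₁ * t + N₂ * (t * t)) * (N₀ + N₁ * t + N₂ * (t * t)))
        - κ * ((M₀ + M₁ * t) * (M₀ + M₁ * t) * (M₀ + M₁ * t))
      raw = solve-∀

  -- Congruences modulo p and the number of roots of a polynomial.

  module Modulo (p : ℕ) (prime : Prime p) (8<p : 8 ℕ.< p) where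

    infix 4 _≈_ _≉_
    infixl 6 _+≈_ _-≈_
    infixl 7 _*≈_

    -- A record keeps `a` and `b` visible to unification; they could not be recovered from their
    -- difference.
    record _≈_ (a b : ℤ) : Set where
      constructor congruent
      field ∣-difference : + p ∣ a - b
    open _≈_

    _≉_ : ℤ → ℤ → Set
    a ≉ b = ¬ a ≈ b

    ≡⇒≈ : ∀ {a b} → a ≡ b → a ≈ b
    ≡⇒≈ {a} refl = congruent (subst (+ p ∣_) (sym (+-inverseʳ a)) (divides 0ℤ refl))

    ≈-refl : ∀ {a} → a ≈ a
    ≈-refl = ≡⇒≈ refl

    ≈-sym : ∀ {a b} → a ≈ b → b ≈ a
    ≈-sym {a} {b} (congruent d) = congruent (subst (+ p ∣_) (flip a b) (∣m⇒∣-m d))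
      where
      flip : ∀ a b → - (a - b) ≡ b - a
      flip = solve-∀

    ≈-trans : ∀ {a b c} → a ≈ b → b ≈ c → a ≈ c
    ≈-trans {a} {b} {c} (congruent d) (congruent e) =
      congruent (subst (+ p ∣_) (telescope a b c) (∣m∣n⇒∣m+n d e))
      where
      telescope : ∀ a b c → (a - b) + (b - c) ≡ a - c
      telescope = solve-∀

    _+≈_ : ∀ {a b c d} → a ≈ b → c ≈ d → a + c ≈ b + d
    _+≈_ {a} {b} {c} {d} (congruent k) (congruent l) =
      congruent (subst (+ p ∣_) (regroup a b c d) (∣m∣n⇒∣m+n k l))
      where
      regroup : ∀ a b c d → (a - b) + (c - d) ≡ (a + c) - (b + d)
      regroup = solve-∀

    _-≈_ : ∀ {a b c d} → a ≈ b → c ≈ d → a - c ≈ b - d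
    _-≈_ {a} {b} {c} {d} (congruent k) (congruent l) =
      congruent (subst (+ p ∣_) (regroup a b c d) (∣m∣n⇒∣m-n k l))
      where
      regroup : ∀ a b c d → (a - b) - (c - d) ≡ (a - c) - (b - d)
      regroup = solve-∀

    _*≈_ : ∀ {a b c d} → a ≈ b → c ≈ d → a * c ≈ b * d
    _*≈_ {a} {b} {c} {d} (congruent k) (congruent l) =
      congruent (subst (+ p ∣_) (regroup a b c d) (∣m∣n⇒∣m+n (∣m⇒∣m*n d k) (∣n⇒∣m*n a l)))
      where
      regroup : ∀ a b c d → (a - b) * d + a * (c - d) ≡ a * c - b * d
      regroup = solve-∀

    a-0≡a : ∀ a → a - 0ℤ ≡ a
    a-0≡a = solve-∀

    ≈⇒-≈0 : ∀ {a b} → a ≈ b → a - b ≈ 0ℤ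
    ≈⇒-≈0 {a} {b} (congruent d) = congruent (subst (+ p ∣_) (sym (a-0≡a (a - b))) d)

    -≈0⇒≈ : ∀ {a b} → a - b ≈ 0ℤ → a ≈ b
    -≈0⇒≈ {a} {b} (congruent d) = congruent (subst (+ p ∣_) (a-0≡a (a - b)) d)

    ≈0⇒∣ : ∀ {a} → a ≈ 0ℤ → p ℕ.∣ ∣ a ∣
    ≈0⇒∣ {a} (congruent d) = ∣⇒∣ᵤ (subst (+ p ∣_) (a-0≡a a) d)

    ∣⇒≈0 : ∀ {a} → p ℕ.∣ ∣ a ∣ → a ≈ 0ℤ
    ∣⇒≈0 {a} p∣a = congruent (subst (+ p ∣_) (sym (a-0≡a a)) (∣ᵤ⇒∣ p∣a))

    -- The largest constant to be cancelled is 8 = 3² - 1², a difference of squared slopes; this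
    -- explains `8 < p`.
    small≉0 : ∀ {a} → .{{ℕ.NonZero ∣ a ∣}} → ∣ a ∣ ℕ.≤ 8 → a ≉ 0ℤ
    small≉0 {a} a≤8 a≈0 = ℕ.<⇒≱ 8<p (ℕ.≤-trans (ℕ.∣⇒≤ (≈0⇒∣ {a} a≈0)) a≤8)

    *≈0 : ∀ a b → a * b ≈ 0ℤ → a ≈ 0ℤ ⊎ b ≈ 0ℤ
    *≈0 a b ab≈0 = Sum.map (∣⇒≈0 {a}) (∣⇒≈0 {b})
      (euclidsLemma ∣ a ∣ ∣ b ∣ prime (subst (p ℕ.∣_) (abs-* a b) (≈0⇒∣ {a * b} ab≈0)))

    *≉0 : ∀ {a b} → a ≉ 0ℤ → b ≉ 0ℤ → a * b ≉ 0ℤ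
    *≉0 {a} {b} a≉0 b≉0 ab≈0 = [ a≉0 , b≉0 ]′ (*≈0 a b ab≈0)

    cancelˡ : ∀ {a b c} → a ≉ 0ℤ → a * b ≈ a * c → b ≈ c
    cancelˡ {a} {b} {c} a≉0 ab≈ac =
      [ (λ a≈0 → contradiction a≈0 a≉0) , -≈0⇒≈ ]′
        (*≈0 a (b - c) (subst (_≈ 0ℤ) (distrib a b c) (≈⇒-≈0 ab≈ac)))
      where
      distrib : ∀ a b c → a * b - a * c ≡ a * (b - c)
      distrib = solve-∀

    ≉0-resp : ∀ {a b} → a ≈ b → b ≉ 0ℤ → a ≉ 0ℤ
    ≉0-resp a≈b b≉0 a≈0 = b≉0 (≈-trans (≈-sym a≈b) a≈0)

    Zeros : List ℤ → Set
    Zeros = All (_≈ 0ℤ)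

    eval-zeros : ∀ {cs} → Zeros cs → ∀ x → eval cs x ≈ 0ℤ
    eval-zeros []       x = ≈-refl
    eval-zeros (z ∷ zs) x = ≈-trans (z +≈ ≈-refl {x} *≈ eval-zeros zs x) (≡⇒≈ (vanish x))
      where
      vanish : ∀ x → 0ℤ + x * 0ℤ ≡ 0ℤ
      vanish = solve-∀

    constant-zero : ∀ {c cs} x → Zeros cs → eval (c ∷ cs) x ≈ 0ℤ → c ≈ 0ℤ
    constant-zero {c} {cs} x zs root = subst₂ _≈_ (cancel c (x * eval cs x)) (vanish x)
      (root -≈ ≈-refl {x} *≈ eval-zeros zs x)
      where
      cancel : ∀ c y → c + y - y ≡ c
      cancel = solve-∀
      vanish : ∀ x → 0ℤ - x * 0ℤ ≡ 0ℤ
      vanish = solve-∀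

    -- The quotient determines the coefficients from the top down: each entry is a Horner value at
    -- `a`, equal to one coefficient of `cs` plus a combination of higher ones already known to
    -- vanish.
    divide-zeros : ∀ {c cs} a → Zeros (divide (c ∷ cs) a) → Zeros cs
    divide-zeros {cs = []}     a _        = []
    divide-zeros {cs = d ∷ cs} a (z ∷ zs) = constant-zero a tail z ∷ tail
      where
      tail : Zeros cs
      tail = divide-zeros a zs

    -- Lagrange's bound by dividing out the first root: `length cs` coefficients mean degree below
    -- `length cs`. Primality enters in cancelling `x - a` at the other roots.
    manyRoots⇒zeros : ∀ cs {xs} → length cs ℕ.≤ length xs → AllPairs _≉_ xs →
                      All (λ x → eval cs x ≈ 0ℤ) xs → Zeros cs
    manyRoots⇒zeros [] _ _ _ = []
    manyRoots⇒zeros (c ∷ cs) {a ∷ xs} (s≤s le) (a≉ ∷ distinct) (root ∷ roots) =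
      constant-zero a tail root ∷ tail
      where
      divided : ∀ {x} → a ≉ x × eval (c ∷ cs) x ≈ 0ℤ → eval (divide (c ∷ cs) a) x ≈ 0ℤ
      divided {x} (a≉x , rx) =
        [ (λ x-a≈0 → contradiction (≈-sym (-≈0⇒≈ x-a≈0)) a≉x) , (λ z → z) ]′
          (*≈0 (x - a) _ (subst₂ _≈_ (eval-divide (c ∷ cs) a x) refl (rx -≈ root)))
      tail : Zeros cs
      tail = divide-zeros a (manyRoots⇒zeros (divide (c ∷ cs) a)
        (subst (ℕ._≤ length xs) (sym (length-divide c cs a)) le) distinct
        (All.map divided (All.zip (a≉ , roots))))

    factorˡ : ∀ {a b} → a ≉ 0ℤ → a * b ≈ 0ℤ → b ≈ 0ℤ
    factorˡ {a} {b} a≉0 ab≈0 = [ (λ a≈0 → contradiction a≈0 a≉0) , (λ b≈0 → b≈0) ]′ (*≈0 a b ab≈0)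

    square≈0 : ∀ {a} → a * a ≈ 0ℤ → a ≈ 0ℤ
    square≈0 {a} aa≈0 = [ (λ a≈0 → a≈0) , (λ a≈0 → a≈0) ]′ (*≈0 a a aa≈0)

    record Moments (α β γ c1 c2 c3 s u v : ℤ) : Set where
      field
        moment1 : α * s + β * u + γ * v ≈ c1
        moment2 : α * (s * s) + β * (u * u) + γ * (v * v) ≈ c2
        moment3 : α * (s * s * s) + β * (u * u * u) + γ * (v * v * v) ≈ c3

    opaque
      unfolding antipodal

      antipodal-cong : ∀ α β t {c1 c2 c3 d1 d2 d3} → c1 ≈ d1 → c2 ≈ d2 → c3 ≈ d3 →
                       antipodal α β t c1 c2 c3 ≈ antipodal α β t d1 d2 d3
      antipodal-cong α β t e1 e2 e3 =
        ≈-refl {+ 4 * (α * (β * β) * (t * t * t))} *≈ (e1 -≈ ≈-refl {α * t})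
        +≈ ≈-refl {+ 3 * (β * β)} *≈ ((e2 -≈ ≈-refl {α * (t * t)}) *≈ (e2 -≈ ≈-refl {α * (t * t)}))
        +≈ (e1 -≈ ≈-refl {α * t}) *≈ (e1 -≈ ≈-refl {α * t}) *≈ (e1 -≈ ≈-refl {α * t}) *≈ (e1 -≈ ≈-refl {α * t})
        -≈ ≈-refl {+ 4 * (β * β)} *≈ (e3 *≈ (e1 -≈ ≈-refl {α * t}))

      a₂-cong : ∀ α β c3 d3 {c1 c2 d1 d2} → c1 ≈ d1 → c2 ≈ d2 → a₂ α β c1 c2 c3 ≈ a₂ α β d1 d2 d3
      a₂-cong α β c3 d3 e1 e2 =
        ≈-refl {+ 6 * (α * α)} *≈ (e1 *≈ e1) -≈ ≈-refl {+ 6 * α * (β * β)} *≈ e2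

    module _ (m : ℤ) {c1 c2 c3 d1 d2 d3 : ℤ} (e1 : c1 ≈ d1) (e2 : c2 ≈ d2) (e3 : c3 ≈ d3) where
      opaque
        unfolding M₀

        M₀-cong : M₀ m c1 c2 c3 ≈ M₀ m d1 d2 d3
        M₀-cong = ≈-refl {m} *≈ e2 -≈ e1 *≈ e1

        M₁-cong : M₁ m c1 c2 c3 ≈ M₁ m d1 d2 d3
        M₁-cong = ≈-refl {0ℤ} -≈ ≈-refl {+ 2 * m} *≈ e1

        N₀-cong : N₀ m c1 c2 c3 ≈ N₀ m d1 d2 d3
        N₀-cong = ≈-refl {m * m} *≈ e3 -≈ ≈-refl {+ 3 * m} *≈ (e1 *≈ e2) +≈ ≈-refl {+ 2} *≈ (e1 *≈ e1 *≈ e1)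

        N₁-cong : N₁ m c1 c2 c3 ≈ N₁ m d1 d2 d3
        N₁-cong = ≈-refl {+ 6 * m} *≈ (e1 *≈ e1) -≈ ≈-refl {+ 3 * (m * m)} *≈ e2

        N₂-cong : N₂ m c1 c2 c3 ≈ N₂ m d1 d2 d3
        N₂-cong = ≈-refl {+ 3 * (m * m)} *≈ e1

    opaque
      unfolding b₂

      b₂-cong : ∀ K κ M₀ N₀ {M₁ N₁ N₂ M₁′ N₁′ N₂′} → M₁ ≈ M₁′ → N₁ ≈ N₁′ → N₂ ≈ N₂′ →
                b₂ K κ M₀ M₁ N₀ N₁ N₂ ≈ b₂ K κ M₀ M₁′ N₀ N₁′ N₂′
      b₂-cong K κ M₀ N₀ e₁ e₂ e₃ =
        ≈-refl {K} *≈ (e₂ *≈ e₂ +≈ ≈-refl {+ 2} *≈ (≈-refl {N₀} *≈ e₃))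
        -≈ ≈-refl {+ 3 * κ} *≈ (≈-refl {M₀} *≈ (e₁ *≈ e₁))

    antipodal-root : ∀ {α β c1 c2 c3 s u v} → Moments α β (- β) c1 c2 c3 s u v → antipodal α β s c1 c2 c3 ≈ 0ℤ
    antipodal-root {α} {β} {s = s} {u} {v} mom =
      ≈-trans (≈-sym (antipodal-cong α β s moment1 moment2 moment3)) (≡⇒≈ (antipodal-vanish α β s u v))
      where open Moments mom

    alternating : ∀ {α c1 c2 c3 s u v} → α ≉ 0ℤ → Moments α α (- α) c1 c2 c3 s u v → s ≉ v → u ≉ v →
                  a₂ α α c1 c2 c3 ≉ 0ℤ
    alternating {α} {c3 = c3} {s} {u} {v} α≉0 mom s≉v u≉v = ≉0-resp
      (≈-trans (a₂-cong α α c3 0ℤ (≈-sym moment1) (≈-sym moment2)) (≡⇒≈ (a₂-alternating α s u v)))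
      (*≉0 (*≉0 (*≉0 (small≉0 {+ 6} (ℕ.m≤m+n 6 2)) (small≉0 {+ 2} (ℕ.m≤m+n 2 6))) (*≉0 (*≉0 α≉0 α≉0) (*≉0 α≉0 α≉0)))
           (*≉0 (s≉v ∘ -≈0⇒≈) (u≉v ∘ -≈0⇒≈)))
      where open Moments mom

    balanced-M : ∀ {β γ c1 c2 c3 s u v} → Moments (- (β + γ)) β γ c1 c2 c3 s u v →
                 M₀ (β + γ) c1 c2 c3 + M₁ (β + γ) c1 c2 c3 * s ≈ β * γ * ((u - v) * (u - v))
    balanced-M {β} {γ} {s = s} {u} {v} mom = ≈-trans
      (≈-sym (M₀-cong (β + γ) moment1 moment2 moment3 +≈ M₁-cong (β + γ) moment1 moment2 moment3 *≈ ≈-refl {s}))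
      (≡⇒≈ (M-central β γ s u v))
      where open Moments mom

    balanced-N : ∀ {β γ c1 c2 c3 s u v} → Moments (- (β + γ)) β γ c1 c2 c3 s u v →
                 N₀ (β + γ) c1 c2 c3 + N₁ (β + γ) c1 c2 c3 * s + N₂ (β + γ) c1 c2 c3 * (s * s) ≈
                 β * γ * (γ - β) * ((u - v) * (u - v) * (u - v))
    balanced-N {β} {γ} {s = s} {u} {v} mom = ≈-trans
      (≈-sym (N₀-cong (β + γ) moment1 moment2 moment3 +≈ N₁-cong (β + γ) moment1 moment2 moment3 *≈ ≈-refl {s}
              +≈ N₂-cong (β + γ) moment1 moment2 moment3 *≈ ≈-refl {s * s}))
      (≡⇒≈ (N-central β γ s u v))
      where open Moments mom

    -- Both terms become K³ d² w⁶.
    balanced-root : ∀ K d w {A B} → A ≈ K * (w * w) → B ≈ K * d * (w * w * w) →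
                    K * (B * B) - d * d * (A * A * A) ≈ 0ℤ
    balanced-root K d w A≈ B≈ = ≈-trans
      (≈-refl {K} *≈ (B≈ *≈ B≈) -≈ ≈-refl {d * d} *≈ (A≈ *≈ A≈ *≈ A≈)) (≡⇒≈ (vanish K d w))
      where
      vanish : ∀ K d w →
        K * ((K * d * (w * w * w)) * (K * d * (w * w * w)))
        - (d * d) * ((K * (w * w)) * (K * (w * w)) * (K * (w * w))) ≡ 0ℤ
      vanish = solve-∀

    module _ (β γ c1 c2 c3 : ℤ) where

      private
        m K κ : ℤ
        m = β + γ
        K = β * γ
        κ = (γ - β) * (γ - β)

      balancedCoeff : ((K κ M₀ M₁ N₀ N₁ N₂ : ℤ) → ℤ) → ℤ
      balancedCoeff b = b (β * γ) ((γ - β) * (γ - β)) (M₀ (β + γ) c1 c2 c3) (M₁ (β + γ) c1 c2 c3)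
        (N₀ (β + γ) c1 c2 c3) (N₁ (β + γ) c1 c2 c3) (N₂ (β + γ) c1 c2 c3)

      -- The leading coefficient is a multiple of the square of `c1`, so `c1` vanishes. Then `b₂`
      -- reduces to a multiple of the square of `c2`, so `c2` vanishes as well, and with both the
      -- second central moment, a nonzero multiple of `(u - v) * (u - v)`.
      balanced⇒u≈v : ∀ {s u v} → β ≉ 0ℤ → γ ≉ 0ℤ → β + γ ≉ 0ℤ →
                     balancedCoeff b₂ ≈ 0ℤ → balancedCoeff b₄ ≈ 0ℤ →
                     Moments (- (β + γ)) β γ c1 c2 c3 s u v → u ≈ v
      balanced⇒u≈v {s} {u} {v} β≉0 γ≉0 m≉0 z₂ z₄ mom =
        -≈0⇒≈ (square≈0 (factorˡ K≉0 (≈-trans (≈-sym (balanced-M mom)) M≈0)))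
        where
        K≉0 : K ≉ 0ℤ
        K≉0 = *≉0 β≉0 γ≉0
        N₂≈0 : N₂ m c1 c2 c3 ≈ 0ℤ
        N₂≈0 = square≈0 (factorˡ K≉0 (subst (_≈ 0ℤ) (b₄-≡ K κ _ _ _ _ (N₂ m c1 c2 c3)) z₄))
        c1≈0 : c1 ≈ 0ℤ
        c1≈0 = factorˡ (*≉0 (small≉0 {+ 3} (ℕ.m≤m+n 3 5)) (*≉0 m≉0 m≉0)) (subst (_≈ 0ℤ) (N₂-≡ m c1 c2 c3) N₂≈0)
        M₁≈0 : M₁ m c1 c2 c3 ≈ 0ℤ
        M₁≈0 = ≈-trans (M₁-cong m c1≈0 (≈-refl {c2}) (≈-refl {c3})) (≡⇒≈ (M₁-0 m c2 c3))
        N₁≈ : N₁ m c1 c2 c3 ≈ (- + 3) * (m * m) * c2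
        N₁≈ = ≈-trans (N₁-cong m c1≈0 (≈-refl {c2}) (≈-refl {c3})) (≡⇒≈ (N₁-0 m c2 c3))
        z₂′ : K * (((- + 3) * (m * m) * c2) * ((- + 3) * (m * m) * c2)) ≈ 0ℤ
        z₂′ = ≈-trans (≈-sym (≈-trans (b₂-cong K κ (M₀ m c1 c2 c3) (N₀ m c1 c2 c3) M₁≈0 N₁≈ N₂≈0)
          (≡⇒≈ (b₂-00 K κ (M₀ m c1 c2 c3) (N₀ m c1 c2 c3) ((- + 3) * (m * m) * c2))))) z₂
        c2≈0 : c2 ≈ 0ℤ
        c2≈0 = factorˡ (*≉0 (small≉0 { - + 3} (ℕ.m≤m+n 3 5)) (*≉0 m≉0 m≉0)) (square≈0 (factorˡ K≉0 z₂′))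
        M₀≈0 : M₀ m c1 c2 c3 ≈ 0ℤ
        M₀≈0 = ≈-trans (M₀-cong m c1≈0 c2≈0 (≈-refl {c3})) (≡⇒≈ (M₀-00 m c3))
        vanish : ∀ s → 0ℤ + 0ℤ * s ≡ 0ℤ
        vanish = solve-∀
        M≈0 : M₀ m c1 c2 c3 + M₁ m c1 c2 c3 * s ≈ 0ℤ
        M≈0 = ≈-trans (M₀≈0 +≈ M₁≈0 *≈ ≈-refl {s}) (≡⇒≈ (vanish s))

    -- An index stands for a path of one fixed pattern and `s` for the parameter that survives
    -- elimination; five distinct values exceed the degree four.
    module Solutions {I : Set} (is : List I) (s u v : I → ℤ) (5≤is : 5 ℕ.≤ length is)
                     (distinct : AllPairs (λ i j → s i ≉ s j) is) where

      commonRoots⇒zeros : ∀ c₀ c₁ c₂ c₃ c₄ →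
        All (λ i → c₀ + s i * (c₁ + s i * (c₂ + s i * (c₃ + s i * (c₄ + s i * 0ℤ)))) ≈ 0ℤ) is →
        c₂ ≈ 0ℤ × c₄ ≈ 0ℤ
      commonRoots⇒zeros c₀ c₁ c₂ c₃ c₄ roots with
        manyRoots⇒zeros (c₀ ∷ c₁ ∷ c₂ ∷ c₃ ∷ c₄ ∷ []) (subst (5 ℕ.≤_) (sym (length-map s is)) 5≤is)
          (AllPairs.map⁺ distinct) (All.map⁺ (All.map (λ {i} → subst (_≈ 0ℤ) (sym (eval₅ c₀ c₁ c₂ c₃ c₄ (s i)))) roots))
      ... | _ ∷ _ ∷ z₂ ∷ _ ∷ z₄ ∷ [] = z₂ , z₄

      nonempty : ∀ {P : I → Set} → All P is → ∃[ i ] P i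
      nonempty {P} all = go all 5≤is
        where
        go : ∀ {is} → All P is → 5 ℕ.≤ length is → ∃[ i ] P i
        go (p ∷ _) _ = _ , p

      antipodal-zeros : ∀ α β c1 c2 c3 → All (λ i → Moments α β (- β) c1 c2 c3 (s i) (u i) (v i)) is →
                        a₂ α β c1 c2 c3 ≈ 0ℤ × a₄ α β ≈ 0ℤ
      antipodal-zeros α β c1 c2 c3 moments = commonRoots⇒zeros
        (a₀ α β c1 c2 c3) (a₁ α β c1 c2 c3) (a₂ α β c1 c2 c3) (a₃ α β c1 c2 c3) (a₄ α β)
        (All.map (λ {i} mom → subst (_≈ 0ℤ) (sym (antipodal-expand α β c1 c2 c3 (s i))) (antipodal-root mom)) moments)

      antipodal-impossible : ∀ α β c1 c2 c3 → α ≉ 0ℤ → α * α - β * β ≉ 0ℤ →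
                             ¬ All (λ i → Moments α β (- β) c1 c2 c3 (s i) (u i) (v i)) is
      antipodal-impossible α β c1 c2 c3 α≉0 αβ moments =
        *≉0 (*≉0 α≉0 α≉0) αβ (subst (_≈ 0ℤ) (a₄-≡ α β) (proj₂ (antipodal-zeros α β c1 c2 c3 moments)))

      alternating-impossible : ∀ α c1 c2 c3 → α ≉ 0ℤ → (∀ i → s i ≉ v i) → (∀ i → u i ≉ v i) →
                               ¬ All (λ i → Moments α α (- α) c1 c2 c3 (s i) (u i) (v i)) is
      alternating-impossible α c1 c2 c3 α≉0 s≉v u≉v moments =
        let i , mom = nonempty moments
        in alternating α≉0 mom (s≉v i) (u≉v i) (proj₁ (antipodal-zeros α α c1 c2 c3 moments))

      balanced-impossible : ∀ β γ c1 c2 c3 → β ≉ 0ℤ → γ ≉ 0ℤ → β + γ ≉ 0ℤ → (∀ i → u i ≉ v i) →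
                            ¬ All (λ i → Moments (- (β + γ)) β γ c1 c2 c3 (s i) (u i) (v i)) is
      balanced-impossible β γ c1 c2 c3 β≉0 γ≉0 m≉0 u≉v moments =
        let i , mom = nonempty moments
            z₂ , z₄ = commonRoots⇒zeros (c b₀) (c b₁) (c b₂) (c b₃) (c b₄) (All.map root moments)
        in u≉v i (balanced⇒u≈v β γ c1 c2 c3 β≉0 γ≉0 m≉0 z₂ z₄ mom)
        where
        c : ((K κ M₀ M₁ N₀ N₁ N₂ : ℤ) → ℤ) → ℤ
        c = balancedCoeff β γ c1 c2 c3
        root : ∀ {i} → Moments (- (β + γ)) β γ c1 c2 c3 (s i) (u i) (v i) →
               c b₀ + s i * (c b₁ + s i * (c b₂ + s i * (c b₃ + s i * (c b₄ + s i * 0ℤ)))) ≈ 0ℤ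
        root {i} mom = subst (_≈ 0ℤ)
          (sym (balanced-expand (β * γ) ((γ - β) * (γ - β)) (M₀ (β + γ) c1 c2 c3) (M₁ (β + γ) c1 c2 c3)
                 (N₀ (β + γ) c1 c2 c3) (N₁ (β + γ) c1 c2 c3) (N₂ (β + γ) c1 c2 c3) (s i)))
          (balanced-root (β * γ) (γ - β) (u i - v i) (balanced-M mom) (balanced-N mom))

-- The algebraic hypergraph and its freeness from thetas.

module LowerBound where

  open Counting
  open ThetaPaths
  open MomentEquations
  open import Data.Nat as ℕ using (ℕ; zero; suc)
  import Data.Nat.Properties as ℕ
  import Data.Nat.Divisibility as ℕ
  open import Data.Nat.Primality using (Prime; prime⇒nonZero)
  open import Data.Integer using (ℤ; +_; _+_; _*_; _-_; -_; 0ℤ; ∣_∣)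
  import Data.Integer.Properties as ℤ
  open import Data.Integer.DivMod using (_%ℕ_; _/ℕ_; n%ℕd<d; a≡a%ℕn+[a/ℕn]*n)
  open import Data.Integer.Divisibility.Signed using (divides)
  open import Data.Integer.Tactic.RingSolver using (solve-∀)
  open import Data.Fin as Fin using (Fin; zero; suc; toℕ; fromℕ<; inject≤; combine; remQuot)
  open import Data.Fin.Patterns using (0F; 1F; 2F)
  open import Data.Fin.Properties as Fin using (toℕ<n; toℕ-fromℕ<; toℕ-injective; toℕ-inject≤; remQuot-combine; all?)
  open import Data.Fin.Subset as Subset using (Subset; ⁅_⁆; _∪_)
  open import Data.Fin.Subset.Properties as Subset using (x∈⁅x⁆; x∈⁅y⁆⇒x≡y; x∈p∪q⁻; x∈p∩q⁻; p⊆p∪q; q⊆p∪q)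
  open import Data.List using (List; []; _∷_; _++_; length; filter; map; tabulate; allFin; cartesianProduct)
  open import Data.List.Properties using (length-++; length-map; length-tabulate)
  open import Data.List.Membership.Propositional using (_∈_)
  open import Data.List.Membership.Propositional.Properties using (∈-filter⁻; ∈-++⁺ˡ; ∈-++⁺ʳ; ∈-map⁻; ∈-tabulate⁺; ∈-allFin)
  open import Data.List.Relation.Unary.Any using (here; there)
  open import Data.List.Relation.Unary.All as All using (All; []; _∷_)
  import Data.List.Relation.Unary.All.Properties as All
  open import Data.List.Relation.Unary.AllPairs as AllPairs using (AllPairs; []; _∷_)
  open import Data.List.Relation.Unary.Unique.Propositional using (Unique)
  import Data.List.Relation.Unary.Unique.Propositional.Properties as Unique
  open import Data.Product using (_×_; _,_; proj₁; proj₂)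
  open import Data.Sum using (inj₁; inj₂)
  open import Data.Empty using (⊥)
  open import Function using (_∘_)
  open import Relation.Nullary using (¬_; Dec; yes; no; contradiction)
  open import Relation.Nullary.Decidable using (_⊎-dec_; _×-dec_; toWitness)
  open import Relation.Binary.PropositionalEquality hiding (J)

  module _ {A : Set} where

    Unique-++⁻ˡ : ∀ (xs : List A) {ys} → Unique (xs ++ ys) → Unique xs
    Unique-++⁻ˡ []       _        = []
    Unique-++⁻ˡ (x ∷ xs) (x∉ ∷ u) = All.++⁻ˡ xs x∉ ∷ Unique-++⁻ˡ xs u

    Unique-++⁻ʳ : ∀ (xs : List A) {ys} → Unique (xs ++ ys) → Unique ys
    Unique-++⁻ʳ []       u       = u
    Unique-++⁻ʳ (x ∷ xs) (_ ∷ u) = Unique-++⁻ʳ xs u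

    Unique-++⁻-≢ : ∀ {xs ys : List A} {x y} → Unique (xs ++ ys) → x ∈ xs → y ∈ ys → x ≢ y
    Unique-++⁻-≢ {x ∷ xs} (x∉ ∷ u) (here refl) y∈ = All.lookup x∉ (∈-++⁺ʳ xs y∈)
    Unique-++⁻-≢ {x ∷ xs} (x∉ ∷ u) (there x∈)  y∈ = Unique-++⁻-≢ u x∈ y∈

    Unique-tabulate⁻ : ∀ {n} {f : Fin n → A} → Unique (tabulate f) → ∀ {i j} → f i ≡ f j → i ≡ j
    Unique-tabulate⁻ (f0∉ ∷ u) {zero}  {zero}  eq = refl
    Unique-tabulate⁻ (f0∉ ∷ u) {zero}  {suc j} eq = contradiction eq (All.lookup f0∉ (∈-tabulate⁺ j))
    Unique-tabulate⁻ (f0∉ ∷ u) {suc i} {zero}  eq = contradiction (sym eq) (All.lookup f0∉ (∈-tabulate⁺ i))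
    Unique-tabulate⁻ (f0∉ ∷ u) {suc i} {suc j} eq = cong suc (Unique-tabulate⁻ u eq)

  Unique⇒AllPairs : ∀ {A : Set} {R : A → A → Set} {xs} → (∀ {x y} → x ∈ xs → y ∈ xs → x ≢ y → R x y) →
                    Unique xs → AllPairs R xs
  Unique⇒AllPairs imp []       = []
  Unique⇒AllPairs imp (x∉ ∷ u) =
    All.tabulate (λ y∈ → imp (here refl) (there y∈) (All.lookup x∉ y∈)) ∷
    Unique⇒AllPairs (λ x∈ y∈ → imp (there x∈) (there y∈)) u

  length-cartesianProduct : ∀ {A B : Set} (xs : List A) (ys : List B) →
                            length (cartesianProduct xs ys) ≡ length xs ℕ.* length ys
  length-cartesianProduct []       ys = refl
  length-cartesianProduct (x ∷ xs) ys = trans (length-++ (map (x ,_) ys))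
    (cong₂ ℕ._+_ (length-map (x ,_) ys) (length-cartesianProduct xs ys))

  pigeonhole : ∀ {X : Set} {k} (f : X → Fin k) m xs → k ℕ.* m ℕ.< length xs →
               ∃[ c ] m ℕ.< length (filter (λ x → f x Fin.≟ c) xs)
  pigeonhole {X} {k} f m xs many with Fin.any? (λ c → m ℕ.<? length (filter (λ x → f x Fin.≟ c) xs))
  ... | yes found = found
  ... | no none   = contradiction total (ℕ.<⇒≱ many)
    where
    open ℕ.≤-Reasoning
    total : length xs ℕ.≤ k ℕ.* m
    total = begin
      length xs
        ≡⟨ trans (sumOver-const xs 1) (ℕ.*-identityʳ _) ⟨
      sumOver xs (λ _ → 1)
        ≤⟨ sumOver-mono xs (λ {x} _ → own x) ⟩
      sumOver xs (λ x → count (λ c → f x Fin.≟ c) (allFin k))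
        ≡⟨ sumOver-swap xs (allFin k) (λ x c → indicator (f x Fin.≟ c)) ⟩
      sumOver (allFin k) (λ c → count (λ x → f x Fin.≟ c) xs)
        ≤⟨ sumOver-mono (allFin k) (λ {c} _ → few c) ⟩
      sumOver (allFin k) (λ _ → m)
        ≡⟨ sumOver-const (allFin k) m ⟩
      length (allFin k) ℕ.* m
        ≡⟨ cong (ℕ._* m) (length-tabulate (λ (c : Fin k) → c)) ⟩
      k ℕ.* m ∎
      where
      few : ∀ c → count (λ x → f x Fin.≟ c) xs ℕ.≤ m
      few c = subst (ℕ._≤ m) (length-filter≡count (λ x → f x Fin.≟ c) xs) (ℕ.≮⇒≥ (λ lt → none (c , lt)))
      own : ∀ x → 1 ℕ.≤ count (λ c → f x Fin.≟ c) (allFin k)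
      own x = member⇒count>0 (f x Fin.≟_) (∈-allFin (f x)) refl

  tripleton : ∀ {n} → Fin n → Fin n → Fin n → Subset n
  tripleton u v w = ⁅ u ⁆ ∪ (⁅ v ⁆ ∪ ⁅ w ⁆)

  ∈-tripleton⁻ : ∀ {n} {u v w x : Fin n} → x Subset.∈ tripleton u v w → x ∈ u ∷ v ∷ w ∷ []
  ∈-tripleton⁻ {u = u} {v} {w} x∈ with x∈p∪q⁻ ⁅ u ⁆ (⁅ v ⁆ ∪ ⁅ w ⁆) x∈
  ... | inj₁ x∈u = here (x∈⁅y⁆⇒x≡y u x∈u)
  ... | inj₂ x∈′ with x∈p∪q⁻ ⁅ v ⁆ ⁅ w ⁆ x∈′
  ...   | inj₁ x∈v = there (here (x∈⁅y⁆⇒x≡y v x∈v))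
  ...   | inj₂ x∈w = there (there (here (x∈⁅y⁆⇒x≡y w x∈w)))

  ∈-tripleton⁺ : ∀ {n} {u v w x : Fin n} → x ∈ u ∷ v ∷ w ∷ [] → x Subset.∈ tripleton u v w
  ∈-tripleton⁺ {u = u} {v} {w} (here refl) = p⊆p∪q (⁅ v ⁆ ∪ ⁅ w ⁆) (x∈⁅x⁆ u)
  ∈-tripleton⁺ {u = u} {v} {w} (there (here refl)) = q⊆p∪q ⁅ u ⁆ (⁅ v ⁆ ∪ ⁅ w ⁆) (p⊆p∪q ⁅ w ⁆ (x∈⁅x⁆ v))
  ∈-tripleton⁺ {u = u} {v} {w} (there (there (here refl))) =
    q⊆p∪q ⁅ u ⁆ (⁅ v ⁆ ∪ ⁅ w ⁆) (q⊆p∪q ⁅ v ⁆ ⁅ w ⁆ (x∈⁅x⁆ w))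

  ∣tripleton∣ : ∀ {n} {u v w : Fin n} → Unique (u ∷ v ∷ w ∷ []) → Subset.∣ tripleton u v w ∣ ≡ 3
  ∣tripleton∣ {u = u} {v} {w} distinct = trans (sym (length-elems (tripleton u v w))) (ℕ.≤-antisym
    (Unique⊆⇒length≤ (Unique-elems (tripleton u v w)) (∈-tripleton⁻ {u = u} {v} {w} ∘ ∈-elems⁻))
    (Unique⊆⇒length≤ distinct (∈-elems⁺ {p = tripleton u v w} ∘ ∈-tripleton⁺ {u = u} {v} {w})))

  -- The squares of the differences of weights are distinct, so that antipodal patterns are nondegenerate.
  weight : Fin 3 → ℤ
  weight 0F = + 0
  weight 1F = + 1
  weight 2F = + 3

  slope : Fin 3 → Fin 3 → ℤ
  slope i j = weight j - weight i

  Small : ℤ → Set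
  Small a = 1 ℕ.≤ ∣ a ∣ × ∣ a ∣ ℕ.≤ 8

  small? : ∀ a → Dec (Small a)
  small? a = (1 ℕ.≤? ∣ a ∣) ×-dec (∣ a ∣ ℕ.≤? 8)

  slope-small : ∀ i j → i ≢ j → Small (slope i j)
  slope-small i j i≢j with toWitness {a? = all? (λ i → all? (λ j → (i Fin.≟ j) ⊎-dec small? (slope i j)))} _ i j
  ... | inj₁ i≡j = contradiction i≡j i≢j
  ... | inj₂ sm  = sm

  slope²-small : ∀ i j k → i ≢ j → i ≢ k → j ≢ k → Small (slope i j * slope i j - slope i k * slope i k)
  slope²-small i j k i≢j i≢k j≢k with
    toWitness {a? = all? (λ i → all? (λ j → all? (λ k → (i Fin.≟ j) ⊎-dec ((i Fin.≟ k) ⊎-dec ((j Fin.≟ k) ⊎-dec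
      small? (slope i j * slope i j - slope i k * slope i k))))))} _ i j k
  ... | inj₁ i≡j = contradiction i≡j i≢j
  ... | inj₂ (inj₁ i≡k) = contradiction i≡k i≢k
  ... | inj₂ (inj₂ (inj₁ j≡k)) = contradiction j≡k j≢k
  ... | inj₂ (inj₂ (inj₂ sm)) = sm

  third-unique : ∀ (a b i j : Fin 3) → a ≢ b → i ≢ a → i ≢ b → j ≢ a → j ≢ b → i ≡ j
  third-unique a b i j a≢b i≢a i≢b j≢a j≢b with
    toWitness {a? = all? (λ a → all? (λ b → all? (λ i → all? (λ j → (a Fin.≟ b) ⊎-dec ((i Fin.≟ a) ⊎-dec
      ((i Fin.≟ b) ⊎-dec ((j Fin.≟ a) ⊎-dec ((j Fin.≟ b) ⊎-dec (i Fin.≟ j)))))))))} _ a b i j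
  ... | inj₁ e = contradiction e a≢b
  ... | inj₂ (inj₁ e) = contradiction e i≢a
  ... | inj₂ (inj₂ (inj₁ e)) = contradiction e i≢b
  ... | inj₂ (inj₂ (inj₂ (inj₁ e))) = contradiction e j≢a
  ... | inj₂ (inj₂ (inj₂ (inj₂ (inj₁ e)))) = contradiction e j≢b
  ... | inj₂ (inj₂ (inj₂ (inj₂ (inj₂ e)))) = e

  slope-neg : ∀ i j → slope j i ≡ - slope i j
  slope-neg i j = neg (weight i) (weight j)
    where
    neg : ∀ a b → a - b ≡ - (b - a)
    neg = solve-∀

  -- Slopes cancel around a closed walk through three copies; a path returning to the copy of its
  -- start therefore has weights of balanced shape.
  slope-triangle : ∀ i j k → slope i j ≡ - (slope j k + slope k i)
  slope-triangle i j k = triangle (weight i) (weight j) (weight k)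
    where
    triangle : ∀ a b c → b - a ≡ - ((c - b) + (a - c))
    triangle = solve-∀

  slope-+ : ∀ i j k → slope i j + slope j k ≡ slope i k
  slope-+ i j k = add (weight i) (weight j) (weight k)
    where
    add : ∀ a b c → (b - a) + (c - b) ≡ c - a
    add = solve-∀

  Triple : Set → Set
  Triple A = A × A × A

  at : ∀ {A} → Fin 3 → Triple A → A
  at 0F (a , _ , _) = a
  at 1F (_ , b , _) = b
  at 2F (_ , _ , c) = c

  triple : ∀ {A : Set} → (Fin 3 → A) → Triple A
  triple f = f 0F , f 1F , f 2F

  at-triple : ∀ {A : Set} k (f : Fin 3 → A) → at k (triple f) ≡ f k
  at-triple 0F f = refl
  at-triple 1F f = refl
  at-triple 2F f = refl

  triple-ext : ∀ {A} {P Q : Triple A} → (∀ k → at k P ≡ at k Q) → P ≡ Q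
  triple-ext eq = cong₂ _,_ (eq 0F) (cong₂ _,_ (eq 1F) (eq 2F))

  power : Fin 3 → ℤ → ℤ
  power 0F t = t
  power 1F t = t * t
  power 2F t = t * t * t

  -- Only the first `3 * p³` vertices carry edges; the other vertices of `Fin n` stay isolated.
  module Construction (p : ℕ) (prime : Prime p) (8<p : 8 ℕ.< p)
                      (n : ℕ) (fits : 3 ℕ.* (p ℕ.* (p ℕ.* p)) ℕ.≤ n) where

    open Modulo p prime 8<p

    private instance
      p≢0 : ℕ.NonZero p
      p≢0 = prime⇒nonZero prime

    ⟪_⟫ : Fin p → ℤ
    ⟪ a ⟫ = + toℕ a

    ⟪⟫-injective : ∀ {a b} → ⟪ a ⟫ ≈ ⟪ b ⟫ → a ≡ b
    ⟪⟫-injective {a} {b} a≈b = toℕ-injective (ℤ.+-injective (ℤ.i-j≡0⇒i≡j ⟪ a ⟫ ⟪ b ⟫ (ℤ.∣i∣≡0⇒i≡0 diff≡0)))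
      where
      p∣ : p ℕ.∣ ∣ ⟪ a ⟫ - ⟪ b ⟫ ∣
      p∣ = ≈0⇒∣ (≈⇒-≈0 a≈b)
      diff<p : ∣ ⟪ a ⟫ - ⟪ b ⟫ ∣ ℕ.< p
      diff<p = ℕ.≤-<-trans
        (subst (ℕ._≤ toℕ a ℕ.⊔ toℕ b) (cong ∣_∣ (sym (ℤ.m-n≡m⊖n (toℕ a) (toℕ b)))) (ℤ.∣m⊝n∣≤m⊔n (toℕ a) (toℕ b)))
        (ℕ.⊔-lub (toℕ<n a) (toℕ<n b))
      diff≡0 : ∣ ⟪ a ⟫ - ⟪ b ⟫ ∣ ≡ 0
      diff≡0 with ∣ ⟪ a ⟫ - ⟪ b ⟫ ∣ | p∣ | diff<p
      ... | zero  | _  | _  = refl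
      ... | suc d | d∣ | lt = contradiction (ℕ.∣⇒≤ d∣) (ℕ.<⇒≱ lt)

    opaque
      residue : ℤ → Fin p
      residue z = fromℕ< (n%ℕd<d z p)

      residue-≈ : ∀ z → ⟪ residue z ⟫ ≈ z
      residue-≈ z = ≈-sym (congruent (divides (z /ℕ p) (begin
        z - ⟪ residue z ⟫                               ≡⟨ cong (λ r → z - + r) (toℕ-fromℕ< (n%ℕd<d z p)) ⟩
        z - + (z %ℕ p)                                  ≡⟨ cong (_- + (z %ℕ p)) (a≡a%ℕn+[a/ℕn]*n z p) ⟩
        + (z %ℕ p) + (z /ℕ p) * + p - + (z %ℕ p)        ≡⟨ cancel (+ (z %ℕ p)) ((z /ℕ p) * + p) ⟩
        (z /ℕ p) * + p                                  ∎)))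
        where
        open ≡-Reasoning
        cancel : ∀ r q → r + q - r ≡ q
        cancel = solve-∀

    Point : Set
    Point = Fin 3 × Triple (Fin p)

    size : ℕ
    size = 3 ℕ.* (p ℕ.* (p ℕ.* p))

    opaque
      encode : Point → Fin n
      encode (i , a , b , c) = inject≤ (combine i (combine a (combine b c))) fits

      split₂ : Fin p × Fin (p ℕ.* p) → Triple (Fin p)
      split₂ (a , r) = a , remQuot p r

      split₁ : Fin 3 × Fin (p ℕ.* (p ℕ.* p)) → Point
      split₁ (i , r) = i , split₂ (remQuot (p ℕ.* p) r)

      split : Fin size → Point
      split u = split₁ (remQuot (p ℕ.* (p ℕ.* p)) u)

      -- The value on vertices outside the image of encode is irrelevant.
      decode : Fin n → Point
      decode u with toℕ u ℕ.<? size
      ... | yes lt = split (fromℕ< lt)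
      ... | no  _  = 0F , triple (λ _ → residue 0ℤ)

      decode-encode : ∀ P → decode (encode P) ≡ P
      decode-encode P@(i , a , b , c) with toℕ (encode P) ℕ.<? size
      ... | no ≮ = contradiction (subst (ℕ._< size) (sym (toℕ-inject≤ code fits)) (toℕ<n code)) ≮
        where
        code : Fin size
        code = combine i (combine a (combine b c))
      ... | yes lt = trans (cong split restored) split-code
        where
        code : Fin size
        code = combine i (combine a (combine b c))
        restored : fromℕ< lt ≡ code
        restored = toℕ-injective (trans (toℕ-fromℕ< lt) (toℕ-inject≤ code fits))
        split-code : split code ≡ P
        split-code = trans (cong split₁ (remQuot-combine i (combine a (combine b c))))
          (cong (i ,_) (trans (cong split₂ (remQuot-combine a (combine b c)))
            (cong (a ,_) (remQuot-combine b c))))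

    class : Fin n → Fin 3
    class u = proj₁ (decode u)

    coord : Fin 3 → Fin n → ℤ
    coord k u = ⟪ at k (proj₂ (decode u)) ⟫

    Line : Set
    Line = Fin p × Triple (Fin p)

    slopeOf : Line → ℤ
    slopeOf (t , _) = ⟪ t ⟫

    position : Line → Fin 3 → Fin 3 → ℤ
    position (t , base) i k = ⟪ at k base ⟫ + weight i * power k ⟪ t ⟫

    point : Line → Fin 3 → Point
    point q i = i , triple (residue ∘ position q i)

    vertex : Line → Fin 3 → Fin n
    vertex q i = encode (point q i)

    class-vertex : ∀ q i → class (vertex q i) ≡ i
    class-vertex q i = cong proj₁ (decode-encode (point q i))

    coord-vertex : ∀ q i k → coord k (vertex q i) ≈ position q i k
    coord-vertex q i k = ≈-trans
      (≡⇒≈ (cong ⟪_⟫ (trans (cong (at k ∘ proj₂) (decode-encode (point q i)))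
                            (at-triple k (residue ∘ position q i)))))
      (residue-≈ (position q i k))

    edge : Line → Subset n
    edge q = tripleton (vertex q 0F) (vertex q 1F) (vertex q 2F)

    vertex∈edge : ∀ q i → vertex q i Subset.∈ edge q
    vertex∈edge q 0F = ∈-tripleton⁺ (here refl)
    vertex∈edge q 1F = ∈-tripleton⁺ (there (here refl))
    vertex∈edge q 2F = ∈-tripleton⁺ (there (there (here refl)))

    ∈edge⇒vertex : ∀ {q u} → u Subset.∈ edge q → u ≡ vertex q (class u)
    ∈edge⇒vertex {q} {u} u∈ with ∈-tripleton⁻ u∈
    ... | here refl                 = cong (vertex q) (sym (class-vertex q 0F))
    ... | there (here refl)         = cong (vertex q) (sym (class-vertex q 1F))
    ... | there (there (here refl)) = cong (vertex q) (sym (class-vertex q 2F))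

    ∈edge⇒coord : ∀ {q u} → u Subset.∈ edge q → ∀ k → coord k u ≈ position q (class u) k
    ∈edge⇒coord {q} {u} u∈ k = subst (λ w → coord k w ≈ position q (class u) k) (sym (∈edge⇒vertex u∈))
      (coord-vertex q (class u) k)

    class-injective : ∀ {q u w} → u Subset.∈ edge q → w Subset.∈ edge q → class u ≡ class w → u ≡ w
    class-injective {q} u∈ w∈ eq = trans (∈edge⇒vertex u∈) (trans (cong (vertex q) eq) (sym (∈edge⇒vertex w∈)))

    -- Coordinates determine a vertex only within the image of `encode`; lying on an edge guarantees
    -- membership in it.
    on-edges-≡ : ∀ {q r u w} → u Subset.∈ edge q → w Subset.∈ edge r → class u ≡ class w →
                 (∀ k → coord k u ≈ coord k w) → u ≡ w
    on-edges-≡ {q} {r} {u} {w} u∈ w∈ class≡ coord≈ =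
      trans (sym (encode-decode {q} u∈)) (trans (cong encode decoded) (encode-decode {r} w∈))
      where
      encode-decode : ∀ {q u} → u Subset.∈ edge q → encode (decode u) ≡ u
      encode-decode {q} {u} u∈ = subst (λ w → encode (decode w) ≡ w) (sym (∈edge⇒vertex {q} u∈))
        (cong encode (decode-encode (point q (class u))))
      decoded : decode u ≡ decode w
      decoded = cong₂ _,_ class≡ (triple-ext (λ k → ⟪⟫-injective {at k (proj₂ (decode u))} {at k (proj₂ (decode w))} (coord≈ k)))

    displacement : ∀ {q u w} → u Subset.∈ edge q → w Subset.∈ edge q → ∀ k →
                   coord k w - coord k u ≈ slope (class u) (class w) * power k (slopeOf q)
    displacement {q} {u} {w} u∈ w∈ k = ≈-trans (∈edge⇒coord w∈ k -≈ ∈edge⇒coord u∈ k)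
      (≡⇒≈ (difference ⟪ at k (proj₂ q) ⟫ (weight (class w)) (weight (class u)) (power k (slopeOf q))))
      where
      difference : ∀ a v w t → (a + v * t) - (a + w * t) ≡ (v - w) * t
      difference = solve-∀

    Small⇒≉0 : ∀ a → Small a → a ≉ 0ℤ
    Small⇒≉0 a (1≤ , ≤8) = small≉0 {a} {{ℕ.>-nonZero 1≤}} ≤8

    slope≉0 : ∀ {i j} → i ≢ j → slope i j ≉ 0ℤ
    slope≉0 {i} {j} i≢j = Small⇒≉0 (slope i j) (slope-small i j i≢j)

    line-≡ : ∀ {q r u} → u Subset.∈ edge q → u Subset.∈ edge r → slopeOf q ≈ slopeOf r → q ≡ r
    line-≡ {t , base} {t′ , base′} {u} u∈q u∈r t≈t′ with ⟪⟫-injective {t} {t′} t≈t′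
    ... | refl = cong (t ,_) (triple-ext (λ k → ⟪⟫-injective (subst₂ _≈_
      (cancel ⟪ at k base ⟫ (weight (class u) * power k ⟪ t ⟫))
      (cancel ⟪ at k base′ ⟫ (weight (class u) * power k ⟪ t ⟫))
      (≈-trans (≈-sym (∈edge⇒coord u∈q k)) (∈edge⇒coord u∈r k) -≈ ≈-refl {weight (class u) * power k ⟪ t ⟫}))))
      where
      cancel : ∀ a b → a + b - b ≡ a
      cancel = solve-∀

    -- The first coordinate of the displacement is the parameter times an invertible slope, so two
    -- points give the parameter, and then one point gives the line.
    line-through-two : ∀ {q r u w} → u ≢ w → u Subset.∈ edge q → w Subset.∈ edge q →
                       u Subset.∈ edge r → w Subset.∈ edge r → q ≡ r
    line-through-two {q} {r} {u} {w} u≢w uq wq ur wr = line-≡ {q} {r} uq ur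
      (cancelˡ (slope≉0 (u≢w ∘ class-injective {q} uq wq))
        (≈-trans (≈-sym (displacement {q} uq wq 0F)) (displacement {r} ur wr 0F)))

    vertices-distinct : ∀ q {i j} → i ≢ j → vertex q i ≢ vertex q j
    vertices-distinct q {i} {j} i≢j eq =
      i≢j (trans (sym (class-vertex q i)) (trans (cong class eq) (class-vertex q j)))

    edge-injective : ∀ {q r} → edge q ≡ edge r → q ≡ r
    edge-injective {q} {r} eq = line-through-two {q} {r} (vertices-distinct q {0F} {1F} (λ ()))
      (vertex∈edge q 0F) (vertex∈edge q 1F)
      (subst (vertex q 0F Subset.∈_) eq (vertex∈edge q 0F)) (subst (vertex q 1F Subset.∈_) eq (vertex∈edge q 1F))

    lines : List Line
    lines = cartesianProduct (allFin p) (cartesianProduct (allFin p) (cartesianProduct (allFin p) (allFin p)))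

    H : Hypergraph3 n
    H = record
      { edges    = map edge lines
      ; distinct = Unique.map⁺ edge-injective (Unique.cartesianProduct⁺ u (Unique.cartesianProduct⁺ u (Unique.cartesianProduct⁺ u u)))
      ; uniform  = All.map⁺ (All.universal (λ q → ∣tripleton∣
          ((vertices-distinct q (λ ()) ∷ vertices-distinct q (λ ()) ∷ []) ∷
           (vertices-distinct q (λ ()) ∷ []) ∷ [] ∷ [])) lines)
      }
      where u = Unique.allFin⁺ p

    numEdges-H : numEdges H ≡ p ℕ.* (p ℕ.* (p ℕ.* p))
    numEdges-H = trans (length-map edge lines)
      (extend (cartesianProduct ps (cartesianProduct ps ps)) (extend (cartesianProduct ps ps) (extend ps p≡)))
      where
      ps = allFin p
      p≡ : length ps ≡ p
      p≡ = length-tabulate (λ (i : Fin p) → i)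
      extend : ∀ {A : Set} (ys : List A) {b} → length ys ≡ b → length (cartesianProduct ps ys) ≡ p ℕ.* b
      extend ys eq = trans (length-cartesianProduct ps ys) (cong₂ ℕ._*_ p≡ eq)

    linear : Linear H
    linear {e} {f} e∈ f∈ e≢f with ∈-map⁻ edge e∈ | ∈-map⁻ edge f∈
    ... | q , _ , refl | r , _ , refl = ℕ.≮⇒≥ λ 1<∣∩∣ →
      let u , w , u∈ , w∈ , u≢w = ∣p∣>1⇒∃≢ 1<∣∩∣
          uq , ur = x∈p∩q⁻ (edge q) (edge r) u∈
          wq , wr = x∈p∩q⁻ (edge q) (edge r) w∈
      in e≢f (cong edge (line-through-two {q} {r} u≢w uq wq ur wr))

    power-cong : ∀ k {s t} → s ≈ t → power k s ≈ power k t
    power-cong 0F e = e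
    power-cong 1F e = e *≈ e
    power-cong 2F e = e *≈ e *≈ e

    module _ {α β γ c1 c2 c3 s u v : ℤ} (mom : Moments α β γ c1 c2 c3 s u v) where
      open Moments mom

      -- Makes the parameter of the third edge the surviving unknown, as needed when the opposite
      -- weights sit on the first two edges.
      rotate : Moments γ α β c1 c2 c3 v s u
      rotate = record
        { moment1 = subst (_≈ c1) (shift (α * s) (β * u) (γ * v)) moment1
        ; moment2 = subst (_≈ c2) (shift (α * (s * s)) (β * (u * u)) (γ * (v * v))) moment2
        ; moment3 = subst (_≈ c3) (shift (α * (s * s * s)) (β * (u * u * u)) (γ * (v * v * v))) moment3 }
        where
        shift : ∀ a b c → a + b + c ≡ c + a + b
        shift = solve-∀

    module NoTheta {t : ℕ} (Θ : ThetaCopy t H) where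
      open ThetaCopy Θ

      verts : Unique (tabulate v1 ++ tabulate v2)
      verts with vertsDistinct
      ... | _ ∷ _ ∷ u = u

      v1-injective : ∀ {i j} → v1 i ≡ v1 j → i ≡ j
      v1-injective = Unique-tabulate⁻ (Unique-++⁻ˡ (tabulate v1) verts)

      v2-injective : ∀ {i j} → v2 i ≡ v2 j → i ≡ j
      v2-injective = Unique-tabulate⁻ (Unique-++⁻ʳ (tabulate v1) verts)

      v1≢v2 : ∀ i → v1 i ≢ v2 i
      v1≢v2 i = Unique-++⁻-≢ verts (∈-tabulate⁺ i) (∈-tabulate⁺ i)

      x≢v1 : ∀ i → x ≢ v1 i
      x≢v1 i with vertsDistinct
      ... | x∉ ∷ _ = All.lookup x∉ (there (∈-++⁺ˡ (∈-tabulate⁺ i)))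

      y≢v2 : ∀ i → y ≢ v2 i
      y≢v2 i with vertsDistinct
      ... | _ ∷ y∉ ∷ _ = All.lookup y∉ (∈-++⁺ʳ (tabulate v1) (∈-tabulate⁺ i))

      e1≢e2 : ∀ i → e1 i ≢ e2 i
      e1≢e2 i = Unique-++⁻-≢ edgesDistinct (∈-tabulate⁺ i) (∈-++⁺ˡ (∈-tabulate⁺ i))

      e2≢e3 : ∀ i → e2 i ≢ e3 i
      e2≢e3 i = Unique-++⁻-≢ (Unique-++⁻ʳ (tabulate e1) edgesDistinct) (∈-tabulate⁺ i) (∈-tabulate⁺ i)

      l1 l2 l3 : Fin t → Line
      l1 i = proj₁ (∈-map⁻ edge (e1∈H i))
      l2 i = proj₁ (∈-map⁻ edge (e2∈H i))
      l3 i = proj₁ (∈-map⁻ edge (e3∈H i))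

      e1≡ : ∀ i → e1 i ≡ edge (l1 i)
      e1≡ i = proj₂ (proj₂ (∈-map⁻ edge (e1∈H i)))

      e2≡ : ∀ i → e2 i ≡ edge (l2 i)
      e2≡ i = proj₂ (proj₂ (∈-map⁻ edge (e2∈H i)))

      e3≡ : ∀ i → e3 i ≡ edge (l3 i)
      e3≡ i = proj₂ (proj₂ (∈-map⁻ edge (e3∈H i)))

      x∈l1 : ∀ i → x Subset.∈ edge (l1 i)
      x∈l1 i = subst (x Subset.∈_) (e1≡ i) (x∈e1 i)

      v1∈l1 : ∀ i → v1 i Subset.∈ edge (l1 i)
      v1∈l1 i = subst (v1 i Subset.∈_) (e1≡ i) (v1∈e1 i)

      v1∈l2 : ∀ i → v1 i Subset.∈ edge (l2 i)
      v1∈l2 i = subst (v1 i Subset.∈_) (e2≡ i) (v1∈e2 i)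

      v2∈l2 : ∀ i → v2 i Subset.∈ edge (l2 i)
      v2∈l2 i = subst (v2 i Subset.∈_) (e2≡ i) (v2∈e2 i)

      v2∈l3 : ∀ i → v2 i Subset.∈ edge (l3 i)
      v2∈l3 i = subst (v2 i Subset.∈_) (e3≡ i) (v2∈e3 i)

      y∈l3 : ∀ i → y Subset.∈ edge (l3 i)
      y∈l3 i = subst (y Subset.∈_) (e3≡ i) (y∈e3 i)

      s1 s2 s3 : Fin t → ℤ
      s1 i = slopeOf (l1 i)
      s2 i = slopeOf (l2 i)
      s3 i = slopeOf (l3 i)

      s1≉s2 : ∀ i → s1 i ≉ s2 i
      s1≉s2 i eq = e1≢e2 i (trans (e1≡ i)
        (trans (cong edge (line-≡ {l1 i} {l2 i} (v1∈l1 i) (v1∈l2 i) eq)) (sym (e2≡ i))))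

      s2≉s3 : ∀ i → s2 i ≉ s3 i
      s2≉s3 i eq = e2≢e3 i (trans (e2≡ i)
        (trans (cong edge (line-≡ {l2 i} {l3 i} (v2∈l2 i) (v2∈l3 i) eq)) (sym (e3≡ i))))

      -- All first edges start at `x`, so the copy and the parameter determine `v1`. The middle
      -- edges have no common end, which is why the polynomial is always taken in the parameter of
      -- an outer edge.
      s1-distinct : ∀ {i j} → class (v1 i) ≡ class (v1 j) → i ≢ j → s1 i ≉ s1 j
      s1-distinct {i} {j} class≡ i≢j s≈ = i≢j (v1-injective
        (on-edges-≡ {l1 i} {l1 j} (v1∈l1 i) (v1∈l1 j) class≡ (λ k → subst₂ _≈_
          (cancel (coord k (v1 i)) (coord k x)) (cancel (coord k (v1 j)) (coord k x))
          (≈-trans (displacement {l1 i} (x∈l1 i) (v1∈l1 i) k)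
            (≈-trans (≡⇒≈ (cong (slope (class x)) class≡) *≈ power-cong k s≈)
              (≈-sym (displacement {l1 j} (x∈l1 j) (v1∈l1 j) k))) +≈ ≈-refl {coord k x}))))
        where
        cancel : ∀ a b → a - b + b ≡ a
        cancel = solve-∀

      s3-distinct : ∀ {i j} → class (v2 i) ≡ class (v2 j) → i ≢ j → s3 i ≉ s3 j
      s3-distinct {i} {j} class≡ i≢j s≈ = i≢j (v2-injective
        (on-edges-≡ {l3 i} {l3 j} (v2∈l3 i) (v2∈l3 j) class≡ (λ k → subst₂ _≈_
          (cancel (coord k (v2 i)) (coord k y)) (cancel (coord k (v2 j)) (coord k y))
          (≈-refl {coord k y} -≈ ≈-trans (displacement {l3 i} (v2∈l3 i) (y∈l3 i) k)
            (≈-trans (≡⇒≈ (cong (λ c → slope c (class y)) class≡) *≈ power-cong k s≈)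
              (≈-sym (displacement {l3 j} (v2∈l3 j) (y∈l3 j) k)))))))
        where
        cancel : ∀ a b → b - (b - a) ≡ a
        cancel = solve-∀

      shift : Fin 3 → ℤ
      shift k = coord k y - coord k x

      total : ∀ i k → slope (class x) (class (v1 i)) * power k (s1 i)
                      + slope (class (v1 i)) (class (v2 i)) * power k (s2 i)
                      + slope (class (v2 i)) (class y) * power k (s3 i) ≈ shift k
      total i k = ≈-trans
        (≈-sym (displacement {l1 i} (x∈l1 i) (v1∈l1 i) k +≈ displacement {l2 i} (v1∈l2 i) (v2∈l2 i) k
                +≈ displacement {l3 i} (v2∈l3 i) (y∈l3 i) k))
        (≡⇒≈ (telescope (coord k x) (coord k (v1 i)) (coord k (v2 i)) (coord k y)))
        where
        telescope : ∀ a b c d → (b - a) + (c - b) + (d - c) ≡ d - a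
        telescope = solve-∀

      module Pattern (A B : Fin 3) (is : List (Fin t)) (unique : Unique is) (5≤is : 5 ℕ.≤ length is)
                     (class-v1 : ∀ {i} → i ∈ is → class (v1 i) ≡ A)
                     (class-v2 : ∀ {i} → i ∈ is → class (v2 i) ≡ B) where

        I J : Fin 3
        I = class x
        J = class y

        Equations : (α β γ : ℤ) (s u v : Fin t → ℤ) → Set
        Equations α β γ s u v =
          All (λ i → Moments α β γ (shift 0F) (shift 1F) (shift 2F) (s i) (u i) (v i)) is

        equations : Equations (slope I A) (slope A B) (slope B J) s1 s2 s3
        equations = All.tabulate (λ {i} i∈ → subst₂
          (λ a b → Moments (slope I a) (slope a b) (slope b J) (shift 0F) (shift 1F) (shift 2F) (s1 i) (s2 i) (s3 i))
          (class-v1 i∈) (class-v2 i∈)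
          (record { moment1 = total i 0F ; moment2 = total i 1F ; moment3 = total i 2F }))

        distinct1 : AllPairs (λ i j → s1 i ≉ s1 j) is
        distinct1 = Unique⇒AllPairs (λ i∈ j∈ → s1-distinct (trans (class-v1 i∈) (sym (class-v1 j∈)))) unique

        distinct3 : AllPairs (λ i j → s3 i ≉ s3 j) is
        distinct3 = Unique⇒AllPairs (λ i∈ j∈ → s3-distinct (trans (class-v2 i∈) (sym (class-v2 j∈)))) unique

        some : ∃[ i ] i ∈ is
        some = first is 5≤is
          where
          first : ∀ (js : List (Fin t)) → 5 ℕ.≤ length js → ∃[ i ] i ∈ js
          first (i ∷ _) _ = i , here refl

        I≢A : I ≢ A
        I≢A eq = let i , i∈ = some in x≢v1 i (class-injective {l1 i} (x∈l1 i) (v1∈l1 i) (trans eq (sym (class-v1 i∈))))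

        A≢B : A ≢ B
        A≢B eq = let i , i∈ = some in
          v1≢v2 i (class-injective {l2 i} (v1∈l2 i) (v2∈l2 i) (trans (class-v1 i∈) (trans eq (sym (class-v2 i∈)))))

        B≢J : B ≢ J
        B≢J eq = let i , i∈ = some in
          y≢v2 i (class-injective {l3 i} (y∈l3 i) (v2∈l3 i) (trans (sym eq) (sym (class-v2 i∈))))

        -- The weights are a, -a, a when both coincidences hold, and a, -a, c or c, b, -b when
        -- exactly one does. With neither, the copies are I, A, B, I and the weights sum to zero.
        impossible : ⊥
        impossible with B Fin.≟ I | A Fin.≟ J
        ... | yes B≡I | yes A≡J = Solutions.alternating-impossible is s3 s1 s2 5≤is distinct3
              (slope I A) (shift 0F) (shift 1F) (shift 2F) (slope≉0 I≢A) (λ i → s2≉s3 i ∘ ≈-sym) s1≉s2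
              (All.map rotate equations′)
          where
          equations′ : Equations (slope I A) (- slope I A) (slope I A) s1 s2 s3
          equations′ = subst₂ (λ β γ → Equations (slope I A) β γ s1 s2 s3)
            (trans (cong (slope A) B≡I) (slope-neg I A)) (cong₂ slope B≡I (sym A≡J)) equations
        ... | yes B≡I | no A≢J = Solutions.antipodal-impossible is s3 s1 s2 5≤is distinct3
              (slope I J) (slope I A) (shift 0F) (shift 1F) (shift 2F) (slope≉0 I≢J)
              (Small⇒≉0 (slope I J * slope I J - slope I A * slope I A) (slope²-small I J A I≢J I≢A (A≢J ∘ sym)))
              (All.map rotate equations′)
          where
          I≢J : I ≢ J
          I≢J = B≢J ∘ trans B≡I
          equations′ : Equations (slope I A) (- slope I A) (slope I J) s1 s2 s3
          equations′ = subst₂ (λ β γ → Equations (slope I A) β γ s1 s2 s3)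
            (trans (cong (slope A) B≡I) (slope-neg I A)) (cong (λ b → slope b J) B≡I) equations
        ... | no B≢I | yes A≡J = Solutions.antipodal-impossible is s1 s2 s3 5≤is distinct1
              (- slope A I) (slope A B) (shift 0F) (shift 1F) (shift 2F)
              (subst (_≉ 0ℤ) (slope-neg A I) (slope≉0 I≢A))
              (subst (_≉ 0ℤ) (squares (slope A I) (slope A B))
                (Small⇒≉0 (slope A I * slope A I - slope A B * slope A B) (slope²-small A I B (I≢A ∘ sym) A≢B (B≢I ∘ sym))))
              equations′
          where
          squares : ∀ a b → a * a - b * b ≡ (- a) * (- a) - b * b
          squares = solve-∀
          equations′ : Equations (- slope A I) (slope A B) (- slope A B) s1 s2 s3
          equations′ = subst₂ (λ α γ → Equations α (slope A B) γ s1 s2 s3)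
            (slope-neg A I) (trans (cong (slope B) (sym A≡J)) (slope-neg A B)) equations
        ... | no B≢I | no A≢J = Solutions.balanced-impossible is s1 s2 s3 5≤is distinct1
              (slope A B) (slope B I) (shift 0F) (shift 1F) (shift 2F) (slope≉0 A≢B) (slope≉0 B≢I)
              (subst (_≉ 0ℤ) (sym (slope-+ A B I)) (slope≉0 (I≢A ∘ sym))) s2≉s3
              equations′
          where
          J≡I : J ≡ I
          J≡I = third-unique A B J I A≢B (A≢J ∘ sym) (B≢J ∘ sym) I≢A (B≢I ∘ sym)
          equations′ : Equations (- (slope A B + slope B I)) (slope A B) (slope B I) s1 s2 s3
          equations′ = subst₂ (λ α γ → Equations α (slope A B) γ s1 s2 s3)
            (slope-triangle I A B) (cong (slope B) J≡I) equations

    theta-free : ∀ {t} → 36 ℕ.< t → ¬ ThetaCopy t H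
    theta-free {t} 36<t Θ = Pattern.impossible (proj₁ (remQuot {3} 3 c)) (proj₂ (remQuot {3} 3 c))
      (filter (λ i → colour i Fin.≟ c) (allFin t)) (Unique.filter⁺ _ (Unique.allFin⁺ t)) 4<
      (λ i∈ → cong proj₁ (classes i∈)) (λ i∈ → cong proj₂ (classes i∈))
      where
      open NoTheta Θ
      open ThetaCopy Θ using (v1; v2)
      colour : Fin t → Fin 9
      colour i = combine (class (v1 i)) (class (v2 i))
      majority = pigeonhole colour 4 (allFin t) (subst (36 ℕ.<_) (sym (length-tabulate (λ (i : Fin t) → i))) 36<t)
      c = proj₁ majority
      4< = proj₂ majority
      classes : ∀ {i} → i ∈ filter (λ i → colour i Fin.≟ c) (allFin t) → (class (v1 i) , class (v2 i)) ≡ remQuot {3} 3 c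
      classes {i} i∈ = trans (sym (remQuot-combine (class (v1 i)) (class (v2 i))))
        (cong (remQuot {3} 3) (proj₂ (∈-filter⁻ (λ i → colour i Fin.≟ c) {xs = allFin t} i∈)))

-- Choice of the prime for given n, and the two bounds combined.

module Bounds where

  open Primes
  open UpperBound
  open LowerBound
  open import Data.Nat
  open import Data.Nat.Properties
  open import Data.Nat.Primality using (Prime)
  open import Data.Nat.Tactic.RingSolver using (solve-∀)
  open import Data.Product using (_×_; _,_)
  open import Relation.Nullary using (yes; no; contradiction)
  open import Relation.Binary.PropositionalEquality

  cube : ℕ → ℕ
  cube m = m * (m * m)

  cube-mono-≤ : ∀ {a b} → a ≤ b → cube a ≤ cube b
  cube-mono-≤ a≤b = *-mono-≤ a≤b (*-mono-≤ a≤b a≤b)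

  m<2^m : ∀ m → m < 2 ^ m
  m<2^m zero    = s≤s z≤n
  m<2^m (suc m) = begin-strict
    suc m           ≡⟨ +-comm 1 m ⟩
    m + 1           <⟨ +-mono-<-≤ (m<2^m m) (m^n>0 2 m) ⟩
    2 ^ m + 2 ^ m   ≡⟨ 2^suc m ⟩
    2 ^ suc m       ∎
    where open ≤-Reasoning

  -- Upward search from `a` for the first step at which `f` passes `n`; `k` is the number of steps
  -- still available.
  bracket : ∀ (f : ℕ → ℕ) {n} k a → f a ≤ n → n < f (k + a) → ∃[ h ] (a ≤ h × f h ≤ n × n < f (suc h))
  bracket f zero a le lt = contradiction le (<⇒≱ lt)
  bracket f {n} (suc k) a le lt with n <? f (suc a)
  ... | yes lt′ = a , ≤-refl , le , lt′
  ... | no  ≮   with bracket f k (suc a) (≮⇒≥ ≮) (subst (λ m → n < f m) (sym (+-suc k a)) lt)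
  ...   | h , 1+a≤h , rest = h , <⇒≤ 1+a≤h , rest

  cube-*-mono : ∀ c {p q} → q ≤ c * p → 3 * cube q ≤ 3 * cube c * cube p
  cube-*-mono c {p} q≤ = ≤-trans (*-monoʳ-≤ 3 (cube-mono-≤ q≤)) (≤-reflexive (collect c p))
    where
    collect : ∀ c p → 3 * (c * p * (c * p * (c * p))) ≡ 3 * (c * (c * c)) * (p * (p * p))
    collect = solve-∀

  -- Opaque, since multiplication by a numeral unfolds to an iterated sum.
  opaque
    ratio : ℕ
    ratio = 3 * cube 32

    ratio-≡ : ratio ≡ 3 * cube 32
    ratio-≡ = refl

    ratio^4>0 : 0 < ratio ^ 4
    ratio^4>0 = m^n>0 ratio 4

  opaque
    -- Enough vertices for the construction over F_p whenever p ≤ 4 ^ h.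
    scale : ℕ → ℕ
    scale h = 3 * cube (2 ^ (h + h))

    h<scale : ∀ h → h < scale h
    h<scale h = begin-strict
      h             ≤⟨ m≤m+n h h ⟩
      h + h         <⟨ m<2^m (h + h) ⟩
      P             ≤⟨ m≤m*n P (P * P) ⟩
      cube P        ≤⟨ m≤m+n (cube P) _ ⟩
      3 * cube P    ∎
      where
      open ≤-Reasoning
      P : ℕ
      P = 2 ^ (h + h)
      instance
        P≢0 : NonZero P
        P≢0 = m^n≢0 2 (h + h)
        PP≢0 : NonZero (P * P)
        PP≢0 = m*n≢0 P P

    prime-scale′ : ∀ k h → 3 ≤ k → k + 3 ≡ h + h → 8 * (h * h) < 2 ^ h →
                   ∃[ p ] (Prime p × 8 < p × 3 * cube p ≤ scale h × scale (suc h) ≤ ratio * cube p)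
    prime-scale′ k h 3≤k k+3≡ big with prime-between k h k+3≡ big
    ... | p , p-prime , 2^k<p , p≤ =
      p , p-prime , ≤-<-trans (^-monoʳ-≤ 2 3≤k) 2^k<p , *-monoʳ-≤ 3 (cube-mono-≤ p≤) ,
      subst (λ c → scale (suc h) ≤ c * cube p) (sym ratio-≡) (cube-*-mono 32 {p} top≤)
      where
      open ≤-Reasoning
      exponent : ∀ k → suc (suc (k + 3)) ≡ 5 + k
      exponent = solve-∀
      -- Origin of 32: the interval for the prime has ratio `2 ^ 3`, and passing to the next scale
      -- adds `2 ^ 2`.
      top≤ : 2 ^ (suc h + suc h) ≤ 32 * p
      top≤ = begin
        2 ^ (suc h + suc h)     ≡⟨ cong (λ e → 2 ^ suc e) (trans (+-suc h h) (cong suc (sym k+3≡))) ⟩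
        2 ^ suc (suc (k + 3))   ≡⟨ cong (2 ^_) (exponent k) ⟩
        2 ^ (5 + k)             ≡⟨ ^-distribˡ-+-* 2 5 k ⟩
        32 * 2 ^ k              ≤⟨ *-monoʳ-≤ 32 (<⇒≤ 2^k<p) ⟩
        32 * p                  ∎

    prime-scale : ∀ h → 10 ≤ h → ∃[ p ] (Prime p × 8 < p × 3 * cube p ≤ scale h × scale (suc h) ≤ ratio * cube p)
    -- With `h` written as `10 + j`, the exponent `k = 2h - 3` is `17 + (j + j)`.
    prime-scale h 10≤h = prime-scale′ (17 + (j + j)) h (m≤m+n 3 (14 + (j + j)))
      (trans (rearrange j) (cong₂ _+_ h≡ h≡)) (subst (λ h → 8 * (h * h) < 2 ^ h) h≡ (8*n*n<2^n j))
      where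
      j : ℕ
      j = h ∸ 10
      h≡ : 10 + j ≡ h
      h≡ = m+[n∸m]≡n 10≤h
      rearrange : ∀ j → 17 + (j + j) + 3 ≡ 10 + j + (10 + j)
      rearrange = solve-∀

  -- Where the exponent 4/3 arises: order p³ vertices against p⁴ edges, and both sides are of order
  -- p¹².
  fourth-power≤ : ∀ r p {n m} → n ≤ r * cube p → m ≡ p * (p * (p * p)) → n ^ 4 ≤ r ^ 4 * m ^ 3
  fourth-power≤ r p n≤ refl = ≤-trans (^-monoˡ-≤ 4 n≤) (≤-reflexive (powers r p))
    where
    powers : ∀ c p → c * (p * (p * p)) * (c * (p * (p * p)) * (c * (p * (p * p)) * (c * (p * (p * p)) * 1))) ≡
             c * (c * (c * (c * 1))) * (p * (p * (p * p)) * (p * (p * (p * p)) * (p * (p * (p * p)) * 1)))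
    powers = solve-∀

  construction⇒lower : ∀ {t n p} r → 36 < t → Prime p → 8 < p → 3 * cube p ≤ n → n ≤ r * cube p →
                       ExLinLower t (r ^ 4) n
  construction⇒lower {t} {n} {p} r 36<t p-prime 8<p fits n≤ =
    H , linear , theta-free 36<t , fourth-power≤ r p n≤ numEdges-H
    where open Construction p p-prime 8<p n fits

  lowerBound : ∀ {t n} → 36 < t → scale 10 ≤ n → ExLinLower t (ratio ^ 4) n
  lowerBound {t} {n} 36<t large =
    let h , 10≤h , scale≤ , <scale = bracket scale (suc n) 10 large
          (≤-<-trans (≤-trans (n≤1+n n) (m≤m+n (suc n) 10)) (h<scale (suc n + 10)))
        p , p-prime , 8<p , 3p³≤ , ≤p³ = prime-scale h 10≤h
    in construction⇒lower ratio 36<t p-prime 8<p (≤-trans 3p³≤ scale≤) (≤-trans (<⇒≤ <scale) ≤p³)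

  -- Both inequalities weaken as the constant grows, so the sum of the two constants serves for
  -- both.
  combine-bounds : ∀ {t N} KL KU → 0 < KL → 0 < N →
                   (∀ {n} → N ≤ n → ExLinLower t KL n) → (∀ n → .{{NonZero n}} → ExLinUpper t KU n) →
                   ∃[ K ] ∃[ N ] (NonZero K × (∀ n → N ≤ n → ExLinLower t K n × ExLinUpper t K n))
  combine-bounds {t} {N} KL KU KL>0 N>0 lower upper =
    KL + KU , N , >-nonZero (≤-trans KL>0 (m≤m+n KL KU)) , λ n N≤n → weaken (lower N≤n) ,
    λ H linear free → ≤-trans (upper n {{>-nonZero (<-≤-trans N>0 N≤n)}} H linear free)
      (*-monoˡ-≤ (n ^ 4) (m≤n+m KU KL))
    where
    weaken : ∀ {n} → ExLinLower t KL n → ExLinLower t (KL + KU) n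
    weaken (H , linear , free , enough) =
      H , linear , free , ≤-trans enough (*-monoˡ-≤ (numEdges H ^ 3) (m≤m+n KL KU))

  exLin-Θ : ∀ t → 36 < t → ∃[ K ] ∃[ N ] (NonZero K × (∀ n → N ≤ n → ExLinLower t K n × ExLinUpper t K n))
  exLin-Θ t 36<t = combine-bounds (ratio ^ 4) (upperConst t) ratio^4>0 (≤-<-trans z≤n (h<scale 10))
    (lowerBound 36<t) (upperBound t)

theorem1p2 : ∃[ K ] ∃[ N ] (NonZero K × (∀ n → N ≤ n → ExLinLower 217 K n × ExLinUpper 217 K n))
theorem1p2 = Bounds.exLin-Θ 217 (m≤m+n 37 180)
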